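{- For every integer $d\ge 2$ and every $n\in\mathbb{N}$, \[ |S_{I^d_2}(n)| \ge \frac{1}{en}\, e^{ -(1+1/(d-1))n}\,(n!)^{d-1-1/(d-1)}. \]
   Context: A $d$-dimensional binary matrix of size $n\times\cdots\times n$ is an element of $\{0,1\}^{[n]^d}$. It is a $d$-dimensional $n$-permutation matrix if it has exactly $n$ $1$-entries and any two distinct $1$-entries differ in every coordinate. A $d$-dimensional binary matrix $P$ of size $k_1\times\cdots\times k_d$ is contained in $A$ of size $n_1\times\cdots\times n_d$ if there are increasing injections $f_i:[k_i]\to[n_i]$ with $p_{i_1,\dots,i_d}=1\Rightarrow a_{f_1(i_1),\dots,f_d(i_d)}=1$; otherwise $A$ avoids $P$. $S_P(n)$ is the set of $d$-dimensional $n$-permutation matrices avoiding $P$. $I^d_k$ is the $d$-dimensional $k$-permutation matrix with $1$-entries at $(i,i,\dots,i)$ for $i\in[k]$. -}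

module Defs where

open import Data.Nat as ℕ using (ℕ; zero; suc; _!; _^_; _*_; _+_; _∸_)
open import Data.Nat.Properties using (_!≢0)
open import Data.Fin as Fin using (Fin; _<_)
open import Data.Fin.Properties using (all?)
open import Data.Bool using (Bool; true)
open import Data.Product using (Σ; Σ-syntax; ∃; ∃-syntax; _×_)
open import Data.List using (List; length)
open import Data.List.Relation.Unary.AllPairs using (AllPairs)
open import Data.Integer using (+_)
open import Data.Rational as ℚ using (ℚ; 0ℚ)
open import Relation.Binary.PropositionalEquality using (_≡_; _≢_)
open import Relation.Nullary using (¬_)
open import Relation.Nullary.Decidable using (⌊_⌋)

Pos : (d : ℕ) → (Fin d → ℕ) → Set
Pos d k = (i : Fin d) → Fin (k i)

BinMatrix : (d : ℕ) → (Fin d → ℕ) → Set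
BinMatrix d k = Pos d k → Bool

_≈P_ : ∀ {d k} → Pos d k → Pos d k → Set
x ≈P y = ∀ i → x i ≡ y i

_≈M_ : ∀ {d k} → BinMatrix d k → BinMatrix d k → Set
A ≈M B = ∀ x → A x ≡ B x

Cube : ℕ → ℕ → Set
Cube d n = BinMatrix d (λ _ → n)

Increasing : ∀ {a b} → (Fin a → Fin b) → Set
Increasing f = ∀ x y → x < y → f x < f y

Contains : ∀ {d k m} → BinMatrix d m → BinMatrix d k → Set
Contains {d} {k} {m} A P =
  Σ[ f ∈ ((i : Fin d) → Fin (k i) → Fin (m i)) ]
    ((∀ i → Increasing (f i)) ×
     (∀ (x : Pos d k) → P x ≡ true → A (λ i → f i (x i)) ≡ true))

Avoids : ∀ {d k m} → BinMatrix d m → BinMatrix d k → Set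
Avoids A P = ¬ Contains A P

-- d-dimensional n-permutation matrix: exactly n 1-entries (enumerated
-- injectively by Fin n), any two distinct 1-entries differ in every coordinate.
IsPermMatrix : (d n : ℕ) → Cube d n → Set
IsPermMatrix d n A =
  (Σ[ v ∈ (Fin n → Pos d (λ _ → n)) ]
     ((∀ j j′ → v j ≈P v j′ → j ≡ j′) ×
      (∀ x → A x ≡ true → ∃[ j ] (x ≈P v j)) ×
      (∀ j → A (v j) ≡ true)))
  × (∀ x y → A x ≡ true → A y ≡ true → ¬ (x ≈P y) → ∀ i → x i ≢ y i)

Id : (d k : ℕ) → Cube d k
Id zero    k x = true
Id (suc d) k x = ⌊ all? (λ i → x i Fin.≟ x Fin.zero) ⌋

record SElem {d : ℕ} {k : Fin d → ℕ} (P : BinMatrix d k) (n : ℕ) : Set where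
  field
    mat    : Cube d n
    isPerm : IsPermMatrix d n mat
    avoids : Avoids mat P

-- "|S_P(n)| ≥ K" is witnessed by a list of pairwise distinct elements of S_P(n)
DistinctList : ∀ {d k} {P : BinMatrix d k} {n} → List (SElem P n) → Set
DistinctList = AllPairs (λ a b → ¬ (SElem.mat a ≈M SElem.mat b))

expPartial : ℕ → ℕ → ℚ
expPartial m zero    = 0ℚ
expPartial m (suc N) = expPartial m N ℚ.+ ((+ (m ^ N)) ℚ./ (N !)) {{N !≢0}}

ℕ→ℚ : ℕ → ℚ
ℕ→ℚ n = + n ℚ./ 1

{-# OPTIONS --safe #-}
module Submission where

-- Write D = d - 1. A d-dimensional permutation matrix avoiding I₂ amounts to a
-- (D-1)-tuple of permutations together with a last one that is an antitone labelling
-- of the poset P of common descents of the tuple. If P has no chain of length L + 1,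
-- ranking its points splits it into L antichains, and ordering within each antichain
-- is free, which leaves at least n!/Lⁿ choices for the last permutation.
-- A given k-subset is a chain for at most (n!/k!)^(D-1) tuples, so at most
-- n^k/(k!)^D (n!)^(D-1) tuples have a chain of length k; taking L ≈ e n^(1/D) makes at
-- least half of all tuples good, and n!^D / (2Lⁿ) is the claimed bound.
-- The number e enters only through (1 + 1/n)ⁿ, so everything but the comparison with
-- the exponential series takes place in ℕ.

open import Defs
open import Data.Nat using (ℕ; _≤_; _!; _^_; _*_; _+_; _∸_)
open import Data.List using (List; length)
open import Data.List.Relation.Unary.AllPairs using (AllPairs)
open import Data.Product using (Σ-syntax; ∃-syntax; _×_)
open import Data.Rational as ℚ using (ℚ)

open import Data.Bool using (true)
open import Data.Bool.Properties using (T-≡)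
open import Data.Fin using (Fin; zero; suc; toℕ; fromℕ<; punchIn; opposite) renaming (_≟_ to _≟ᶠ_)
open import Data.Fin.Properties using (toℕ<n; toℕ-fromℕ<; toℕ-injective; toℕ≤pred[n]; punchIn-injective; punchInᵢ≢i; punchIn-mono-≤; any?; all?; opposite-prop; opposite-involutive)
open import Data.Fin.Subset using (Subset; inside; outside; ∣_∣; ⊥) renaming (_∈_ to _∈ˢ_)
open import Data.Fin.Subset.Properties using (∣p∣≤n; ∣⊥∣≡0; ∉⊥)
import Data.Integer as ℤ
import Data.Integer.Properties as ℤ
open import Data.List using ([]; _∷_; _++_; map; concatMap; cartesianProductWith)
open import Data.List.Membership.Propositional using (_∈_)
open import Data.List.Membership.Propositional.Properties using (∈-∃++; ∈-++⁻; ∈-++⁺ˡ; ∈-++⁺ʳ; ∈-map⁺; ∈-map⁻; ∈-concatMap⁺; ∈-concatMap⁻; ∈-cartesianProductWith⁺; ∈-cartesianProductWith⁻)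
open import Data.List.Properties using (length-++; length-map)
open import Data.List.Relation.Unary.All as All using (All; []; _∷_)
import Data.List.Relation.Unary.All.Properties as All
open import Data.List.Relation.Unary.AllPairs as AllPairs using ([]; _∷_)
import Data.List.Relation.Unary.AllPairs.Properties as AllPairs
open import Data.List.Relation.Unary.Any as Any using (here; there)
open import Data.List.Relation.Unary.Unique.Propositional using (Unique)
import Data.List.Relation.Unary.Unique.Propositional.Properties as Unique
open import Data.Nat
open import Data.Nat.Combinatorics using (_C_; nCk+nC[k+1]≡[n+1]C[k+1]; nC1≡n)
open import Data.Nat.Combinatorics.Specification using (k>n⇒nCk≡0)
open import Data.Nat.Properties
open import Data.Nat.Tactic.RingSolver using (solve-∀)
open import Data.Product using (_,_; proj₁; proj₂)
import Data.Rational.Properties as ℚ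
import Data.Rational.Unnormalised as ℚᵘ
import Data.Rational.Unnormalised.Properties as ℚᵘ
open import Data.Sum using (_⊎_; inj₁; inj₂; [_,_])
open import Data.Vec as Vec using (Vec; []; _∷_; lookup; count; here; there)
open import Data.Vec.Properties using (count≤n; tabulate∘lookup; tabulate-cong)
open import Function using (_∘_)
open import Function.Bundles using (Equivalence)
open import Level using (Level)
open import Relation.Binary.Definitions using (tri<; tri≈; tri>)
open import Relation.Binary.PropositionalEquality hiding ([_])
open import Relation.Nullary using (¬_; Dec; yes; no; contradiction)
open import Relation.Nullary.Decidable using (⌊_⌋; toWitness; fromWitness)
open import Relation.Unary using (Pred; Decidable)

-- The number e n^(1/D) is never computed. `L` is pinned by comparing integers: the failed test
-- `2 * n ^ L ≤ (L !) ^ D` bounds `L` from above, because L! is at least 2 (L/e)^L, while the passed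
-- test at `L + 1` keeps the chains few. Since (1 + 1/k)ᵏ increases with k, the single fraction (1 +
-- 1/n)ⁿ can stand for e at every k up to `n`, which is why `L` is also kept at most `n`. With one
-- fraction throughout, the powers of e simply add up, and only their total M is compared, once,
-- with the series of e^M. The 2 lost by discarding half of the tuples is absorbed by 2 ≤ (1 +
-- 1/n)ⁿ; this is the e in the factor 1/(en) of the claim.

open ≤-Reasoning

-- Bernoulli, binomial and exponential estimates

x^[1+m]+[1+m]x^m≤[1+x]^[1+m] : ∀ x m → x ^ suc m + suc m * x ^ m ≤ suc x ^ suc m
x^[1+m]+[1+m]x^m≤[1+x]^[1+m] x zero    = ≤-reflexive (eq x)
  where
  eq : ∀ x → x * 1 + 1 ≡ 1 * 1 + x * 1
  eq = solve-∀
x^[1+m]+[1+m]x^m≤[1+x]^[1+m] x (suc m) = begin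
  x * (x * p) + suc (suc m) * (x * p)                      ≤⟨ m≤m+n _ (suc m * p) ⟩
  x * (x * p) + suc (suc m) * (x * p) + suc m * p          ≡⟨ eq x m p ⟩
  suc x * (x * p + suc m * p)                              ≤⟨ *-monoʳ-≤ (suc x) (x^[1+m]+[1+m]x^m≤[1+x]^[1+m] x m) ⟩
  suc x ^ suc (suc m)                                      ∎
  where
  p = x ^ m
  eq : ∀ x m p → x * (x * p) + (2 + m) * (x * p) + (1 + m) * p ≡ (1 + x) * (x * p + (1 + m) * p)
  eq = solve-∀

-- The difference of the two powers telescopes into `suc m` products of `m` factors, each factor at
-- most `suc x`.
[1+x]^[1+m]≤x^[1+m]+[1+m][1+x]^m : ∀ x m → suc x ^ suc m ≤ x ^ suc m + suc m * suc x ^ m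
[1+x]^[1+m]≤x^[1+m]+[1+m][1+x]^m x zero    = ≤-reflexive (eq x)
  where
  eq : ∀ x → 1 * 1 + x * 1 ≡ x * 1 + 1
  eq = solve-∀
[1+x]^[1+m]≤x^[1+m]+[1+m][1+x]^m x (suc m) = begin
  suc x * (suc x * q)                                      ≤⟨ *-monoʳ-≤ (suc x) ([1+x]^[1+m]≤x^[1+m]+[1+m][1+x]^m x m) ⟩
  suc x * (x ^ suc m + suc m * q)                          ≡⟨ eq x m q (x ^ suc m) ⟩
  x * x ^ suc m + (x ^ suc m + suc m * (suc x * q))        ≤⟨ +-monoʳ-≤ (x * x ^ suc m) (+-monoˡ-≤ (suc m * (suc x * q)) (^-monoˡ-≤ (suc m) (n≤1+n x))) ⟩
  x ^ suc (suc m) + suc (suc m) * suc x ^ suc m            ∎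
  where
  q = suc x ^ m
  eq : ∀ x m q r → (1 + x) * (r + (1 + m) * q) ≡ x * r + (r + (1 + m) * ((1 + x) * q))
  eq = solve-∀

^-distribʳ-* : ∀ a b m → (a * b) ^ m ≡ a ^ m * b ^ m
^-distribʳ-* a b zero    = refl
^-distribʳ-* a b (suc m) = trans (cong (a * b *_) (^-distribʳ-* a b m)) (eq a b (a ^ m) (b ^ m))
  where
  eq : ∀ a b p q → a * b * (p * q) ≡ a * p * (b * q)
  eq = solve-∀

-- Bernoulli's inequality for k(k+2)/(k+1)² = 1 - 1/(k+1)² with exponent k + 1 gives the classical
-- step from (1 + 1/k)ᵏ to (1 + 1/(k+1))^(k+1). Multiplying by `k` and adding `X` on both sides
-- avoids fractions and subtraction.
[1+1/k]^k-step : ∀ k .{{_ : NonZero k}} → suc k ^ k * suc k ^ suc k ≤ k ^ k * suc (suc k) ^ suc k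
[1+1/k]^k-step k = *-cancelʳ-≤ _ _ k (+-cancelʳ-≤ X _ _ (begin
  X * k + X                                ≡⟨ eq₁ k X ⟩
  X * suc k                                ≡⟨ eq₂ (suc k) p ⟩
  suc k * suc k * (p * p)                  ≡⟨ cong (suc k * suc k *_) (^-distribʳ-* (suc k) (suc k) k) ⟨
  (suc k * suc k) ^ suc k                  ≡⟨ cong (_^ suc k) (eq₃ k) ⟩
  suc a ^ suc k                            ≤⟨ [1+x]^[1+m]≤x^[1+m]+[1+m][1+x]^m a k ⟩
  a ^ suc k + suc k * suc a ^ k            ≡⟨ cong₂ _+_ (^-distribʳ-* k (suc (suc k)) (suc k)) (cong (λ b → suc k * b ^ k) (sym (eq₃ k))) ⟩
  k ^ suc k * r + suc k * (suc k * suc k) ^ k ≡⟨ cong (λ b → k ^ suc k * r + suc k * b) (^-distribʳ-* (suc k) (suc k) k) ⟩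
  k ^ suc k * r + suc k * (p * p)          ≡⟨ eq₄ k (k ^ k) r (suc k) p ⟩
  k ^ k * r * k + X                        ∎))
  where
  a = k * suc (suc k)
  p = suc k ^ k
  r = suc (suc k) ^ suc k
  X = suc k ^ k * suc k ^ suc k
  eq₁ : ∀ k X → X * k + X ≡ X * (1 + k)
  eq₁ = solve-∀
  eq₂ : ∀ b p → p * (b * p) * b ≡ b * b * (p * p)
  eq₂ = solve-∀
  eq₃ : ∀ k → (1 + k) * (1 + k) ≡ 1 + k * (2 + k)
  eq₃ = solve-∀
  eq₄ : ∀ k q r b p → k * q * r + b * (p * p) ≡ q * r * k + p * (b * p)
  eq₄ = solve-∀

[1+1/k]^k-mono : ∀ {k n} .{{_ : NonZero k}} → k ≤′ n → suc k ^ k * n ^ n ≤ k ^ k * suc n ^ n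
[1+1/k]^k-mono {k} ≤′-refl = ≤-reflexive (*-comm (suc k ^ k) (k ^ k))
[1+1/k]^k-mono {k} {suc n} (≤′-step k≤n) = *-cancelʳ-≤ _ _ (n ^ n) {{m^n≢0 n n}} (begin
  suc k ^ k * suc n ^ suc n * n ^ n        ≡⟨ eq₁ (suc k ^ k) (suc n ^ suc n) (n ^ n) ⟩
  suc k ^ k * n ^ n * suc n ^ suc n        ≤⟨ *-monoˡ-≤ (suc n ^ suc n) ([1+1/k]^k-mono k≤n) ⟩
  k ^ k * suc n ^ n * suc n ^ suc n        ≡⟨ *-assoc (k ^ k) (suc n ^ n) (suc n ^ suc n) ⟩
  k ^ k * (suc n ^ n * suc n ^ suc n)      ≤⟨ *-monoʳ-≤ (k ^ k) ([1+1/k]^k-step n) ⟩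
  k ^ k * (n ^ n * suc (suc n) ^ suc n)    ≡⟨ eq₂ (k ^ k) (n ^ n) (suc (suc n) ^ suc n) ⟩
  k ^ k * suc (suc n) ^ suc n * n ^ n      ∎)
  where
  instance
    n≢0 : NonZero n
    n≢0 = >-nonZero (≤-trans (>-nonZero⁻¹ k) (≤′⇒≤ k≤n))
  eq₁ : ∀ a b c → a * b * c ≡ a * c * b
  eq₁ = solve-∀
  eq₂ : ∀ a b c → a * (b * c) ≡ a * c * b
  eq₂ = solve-∀

2n^n≤[1+n]^n : ∀ n .{{_ : NonZero n}} → 2 * n ^ n ≤ suc n ^ n
2n^n≤[1+n]^n n@(suc m) = begin
  2 * n ^ n               ≡⟨ cong (n ^ n +_) (+-identityʳ (n ^ n)) ⟩
  n ^ n + n * n ^ m       ≤⟨ x^[1+m]+[1+m]x^m≤[1+x]^[1+m] n m ⟩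
  suc n ^ n               ∎

-- Telescoping kᵏ/k! = ∏_{j<k} (1 + 1/j)ʲ bounds it by (1 + 1/n)^(n(k-1)); one more factor gives the 2.
2k^k≤k!e^k : ∀ {n} k → suc k ≤ n → 2 * suc k ^ suc k * (n ^ n) ^ suc k ≤ (suc k) ! * (suc n ^ n) ^ suc k
2k^k≤k!e^k {n} zero 1≤n = begin
  2 * (n ^ n * 1)     ≡⟨ eq (n ^ n) ⟩
  2 * n ^ n           ≤⟨ 2n^n≤[1+n]^n n {{>-nonZero 1≤n}} ⟩
  suc n ^ n           ≡⟨ eq′ (suc n ^ n) ⟨
  1 * (suc n ^ n * 1) ∎
  where
  eq : ∀ a → 2 * (a * 1) ≡ 2 * a
  eq = solve-∀
  eq′ : ∀ a → 1 * (a * 1) ≡ a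
  eq′ = solve-∀
2k^k≤k!e^k {n} (suc k′) k<n = begin
  2 * (suc k * suc k ^ k) * (A * A ^ k)   ≡⟨ eq₁ (suc k) (suc k ^ k) A (A ^ k) ⟩
  suc k * (2 * A ^ k) * (suc k ^ k * A)   ≤⟨ *-monoʳ-≤ (suc k * (2 * A ^ k)) ([1+1/k]^k-mono (≤⇒≤′ (<⇒≤ k<n))) ⟩
  suc k * (2 * A ^ k) * (k ^ k * B)       ≡⟨ eq₂ (suc k) (A ^ k) (k ^ k) B ⟩
  suc k * B * (2 * k ^ k * A ^ k)         ≤⟨ *-monoʳ-≤ (suc k * B) (2k^k≤k!e^k k′ (<⇒≤ k<n)) ⟩
  suc k * B * (k ! * B ^ k)               ≡⟨ eq₃ (suc k) B (k !) (B ^ k) ⟩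
  suc k * k ! * (B * B ^ k)               ∎
  where
  k = suc k′
  A = n ^ n
  B = suc n ^ n
  eq₁ : ∀ s p a q → 2 * (s * p) * (a * q) ≡ s * (2 * q) * (p * a)
  eq₁ = solve-∀
  eq₂ : ∀ s q p b → s * (2 * q) * (p * b) ≡ s * b * (2 * p * q)
  eq₂ = solve-∀
  eq₃ : ∀ s b f q → s * b * (f * q) ≡ s * f * (b * q)
  eq₃ = solve-∀

[1+k]*[1+n]C[1+k]≡[1+n]*nCk : ∀ n k → suc k * (suc n C suc k) ≡ suc n * (n C k)
[1+k]*[1+n]C[1+k]≡[1+n]*nCk n zero = trans (+-identityʳ _) (trans (nC1≡n (suc n)) (sym (*-identityʳ (suc n))))
[1+k]*[1+n]C[1+k]≡[1+n]*nCk zero (suc k) = trans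
  (cong (suc (suc k) *_) (k>n⇒nCk≡0 {1} {suc (suc k)} (s≤s (s≤s z≤n))))
  (trans (*-zeroʳ (suc (suc k))) (sym (cong (1 *_) (k>n⇒nCk≡0 {0} {suc k} (s≤s z≤n)))))
[1+k]*[1+n]C[1+k]≡[1+n]*nCk (suc n) (suc j) = begin-equality
  suc (suc j) * (suc (suc n) C suc (suc j))          ≡⟨ cong (suc (suc j) *_) (nCk+nC[k+1]≡[n+1]C[k+1] (suc n) (suc j)) ⟨
  suc (suc j) * (c + (suc n C suc (suc j)))          ≡⟨ eq₁ j c (suc n C suc (suc j)) ⟩
  c + (suc j * c + suc (suc j) * (suc n C suc (suc j))) ≡⟨ cong (c +_) (cong₂ _+_ ([1+k]*[1+n]C[1+k]≡[1+n]*nCk n j) ([1+k]*[1+n]C[1+k]≡[1+n]*nCk n (suc j))) ⟩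
  c + (suc n * (n C j) + suc n * (n C suc j))        ≡⟨ cong (c +_) (*-distribˡ-+ (suc n) (n C j) (n C suc j)) ⟨
  c + suc n * (n C j + n C suc j)                    ≡⟨ cong (λ x → c + suc n * x) (nCk+nC[k+1]≡[n+1]C[k+1] n j) ⟩
  suc (suc n) * c                                    ∎
  where
  c = suc n C suc j
  eq₁ : ∀ j c x → (2 + j) * (c + x) ≡ c + ((1 + j) * c + (2 + j) * x)
  eq₁ = solve-∀

nCk*k!≤n^k : ∀ n k → (n C k) * k ! ≤ n ^ k
nCk*k!≤n^k n zero = ≤-refl
nCk*k!≤n^k zero (suc k) = ≤-reflexive (cong (_* (suc k) !) (k>n⇒nCk≡0 {0} {suc k} (s≤s z≤n)))
nCk*k!≤n^k (suc n) (suc k) = begin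
  (suc n C suc k) * (suc k * k !)    ≡⟨ eq (suc n C suc k) (suc k) (k !) ⟩
  suc k * (suc n C suc k) * k !      ≡⟨ cong (_* k !) ([1+k]*[1+n]C[1+k]≡[1+n]*nCk n k) ⟩
  suc n * (n C k) * k !              ≡⟨ *-assoc (suc n) (n C k) (k !) ⟩
  suc n * ((n C k) * k !)            ≤⟨ *-monoʳ-≤ (suc n) (≤-trans (nCk*k!≤n^k n k) (^-monoˡ-≤ k (n≤1+n n))) ⟩
  suc n ^ suc k                      ∎
  where
  eq : ∀ a b c → a * (b * c) ≡ b * a * c
  eq = solve-∀

[k+m]Ck*k!*m!≡[k+m]! : ∀ k m → ((k + m) C k) * k ! * m ! ≡ (k + m) !
[k+m]Ck*k!*m!≡[k+m]! zero m = +-identityʳ (m !)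
[k+m]Ck*k!*m!≡[k+m]! (suc k) m = begin-equality
  (suc (k + m) C suc k) * (suc k * k !) * m !  ≡⟨ eq (suc (k + m) C suc k) (suc k) (k !) (m !) ⟩
  suc k * (suc (k + m) C suc k) * (k ! * m !)  ≡⟨ cong (_* (k ! * m !)) ([1+k]*[1+n]C[1+k]≡[1+n]*nCk (k + m) k) ⟩
  suc (k + m) * ((k + m) C k) * (k ! * m !)    ≡⟨ eq′ (suc (k + m)) ((k + m) C k) (k !) (m !) ⟩
  suc (k + m) * (((k + m) C k) * k ! * m !)    ≡⟨ cong (suc (k + m) *_) ([k+m]Ck*k!*m!≡[k+m]! k m) ⟩
  suc (k + m) * (k + m) !                      ∎
  where
  eq : ∀ a b c d → a * (b * c) * d ≡ b * a * (c * d)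
  eq = solve-∀
  eq′ : ∀ a b c d → a * b * (c * d) ≡ a * (b * c * d)
  eq′ = solve-∀

-- One term of the binomial expansion of (1 + L)^(a + b), cleared of denominators; the induction
-- step is Pascal's rule.
[a+b]!*L^b≤[1+L]^[a+b]*a!*b! : ∀ L a b → (a + b) ! * L ^ b ≤ suc L ^ (a + b) * (a ! * b !)
[a+b]!*L^b≤[1+L]^[a+b]*a!*b! L zero b = begin
  b ! * L ^ b                   ≤⟨ *-monoʳ-≤ (b !) (^-monoˡ-≤ b (n≤1+n L)) ⟩
  b ! * suc L ^ b               ≡⟨ *-comm (b !) (suc L ^ b) ⟩
  suc L ^ b * b !               ≡⟨ cong (suc L ^ b *_) (+-identityʳ (b !)) ⟨
  suc L ^ b * (1 * b !)         ∎
[a+b]!*L^b≤[1+L]^[a+b]*a!*b! L (suc a) zero rewrite +-identityʳ a = begin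
  (suc a) ! * 1                 ≤⟨ *-monoʳ-≤ ((suc a) !) (m^n>0 (suc L) (suc a)) ⟩
  (suc a) ! * suc L ^ suc a     ≡⟨ *-comm ((suc a) !) (suc L ^ suc a) ⟩
  suc L ^ suc a * (suc a) !     ≡⟨ cong (suc L ^ suc a *_) (*-identityʳ ((suc a) !)) ⟨
  suc L ^ suc a * ((suc a) ! * 1) ∎
[a+b]!*L^b≤[1+L]^[a+b]*a!*b! L (suc a) (suc b) = begin
  suc s * s ! * (L * L ^ b)                        ≡⟨ eq₁ a (suc b) (s !) L (L ^ b) ⟩
  suc a * (s ! * L ^ suc b) + suc b * L * (s ! * L ^ b)
                                                   ≤⟨ +-mono-≤ (*-monoʳ-≤ (suc a) (IH₁ )) (*-monoʳ-≤ (suc b * L) IH₂) ⟩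
  suc a * (q * (a ! * (suc b) !)) + suc b * L * (q * ((suc a) ! * b !))
                                                   ≡⟨ eq₂ (suc a) (suc b) L q (a !) (b !) ⟩
  suc L * q * ((suc a) ! * (suc b) !)              ∎
  where
  s = a + suc b
  q = suc L ^ s
  IH₁ = [a+b]!*L^b≤[1+L]^[a+b]*a!*b! L a (suc b)
  IH₂ : s ! * L ^ b ≤ q * ((suc a) ! * b !)
  IH₂ = subst (λ t → t ! * L ^ b ≤ suc L ^ t * ((suc a) ! * b !)) (sym (+-suc a b)) ([a+b]!*L^b≤[1+L]^[a+b]*a!*b! L (suc a) b)
  eq₁ : ∀ a b f L p → (1 + (a + b)) * f * (L * p) ≡ (1 + a) * (f * (L * p)) + b * L * (f * p)
  eq₁ = solve-∀
  eq₂ : ∀ a b L q x y → a * (q * (x * (b * y))) + b * L * (q * (a * x * y)) ≡ (1 + L) * q * (a * x * (b * y))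
  eq₂ = solve-∀

-- nᴺ N! ∑_{i<N} (x/n)ⁱ/i!.
scaledExp : ℕ → ℕ → ℕ → ℕ
scaledExp n x zero    = 0
scaledExp n x (suc N) = suc N * n * (scaledExp n x N + x ^ N)

-- For the series E_N truncated after N terms this is a tangent bound, E_(N+1)(x/n) + E_N(x/n)/n ≤
-- E_(N+1)((x+1)/n), as E_N is the derivative of E_(N+1). Term by term it is Bernoulli's inequality.
scaledExp-shift : ∀ n x N → scaledExp n x (suc N) + suc N * scaledExp n x N ≤ scaledExp n (suc x) (suc N)
scaledExp-shift n x zero    = ≤-reflexive (+-identityʳ _)
scaledExp-shift n x (suc N) = begin
  suc (suc N) * n * (f₁ + x ^ suc N) + suc (suc N) * (suc N * n * (f₀ + x ^ N))
    ≡⟨ eq N n f₁ (x ^ suc N) f₀ (x ^ N) ⟩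
  suc (suc N) * n * ((f₁ + suc N * f₀) + (x ^ suc N + suc N * x ^ N))
    ≤⟨ *-monoʳ-≤ (suc (suc N) * n) (+-mono-≤ (scaledExp-shift n x N) (x^[1+m]+[1+m]x^m≤[1+x]^[1+m] x N)) ⟩
  suc (suc N) * n * (scaledExp n (suc x) (suc N) + suc x ^ suc N) ∎
  where
  f₀ = scaledExp n x N
  f₁ = scaledExp n x (suc N)
  eq : ∀ N n f p g q → (2 + N) * n * (f + p) + (2 + N) * ((1 + N) * n * (g + q)) ≡ (2 + N) * n * ((f + (1 + N) * g) + (p + (1 + N) * q))
  eq = solve-∀

-- Unscaled: (1 + 1/n)^q is at most the sum of (q/n)ⁱ/i! over i ≤ q. Each induction step multiplies
-- by 1 + 1/n: the 1 is covered by the series with one more term at the same argument, the 1/n by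
-- moving the argument with `scaledExp-shift`.
[1+n]^q≤scaledExp : ∀ n q → suc n ^ q * (suc q) ! * n ≤ scaledExp n q (suc q)
[1+n]^q≤scaledExp n zero = ≤-reflexive (eq n)
  where
  eq : ∀ n → 1 * 1 * n ≡ (n + 0) * 1
  eq = solve-∀
[1+n]^q≤scaledExp n (suc q) = begin
  suc n * suc n ^ q * (suc N * N !) * n            ≡⟨ eq₁ (suc n) (suc n ^ q) (suc N) (N !) n ⟩
  suc n * suc N * (suc n ^ q * N ! * n)            ≤⟨ *-monoʳ-≤ (suc n * suc N) ([1+n]^q≤scaledExp n q) ⟩
  suc n * suc N * f                                ≡⟨ eq₂ n (suc N) f ⟩
  suc N * n * f + suc N * f                        ≤⟨ +-monoˡ-≤ (suc N * f) (*-monoʳ-≤ (suc N * n) (m≤m+n f (q ^ N))) ⟩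
  scaledExp n q (suc N) + suc N * f                ≤⟨ scaledExp-shift n q N ⟩
  scaledExp n N (suc N)                            ∎
  where
  N = suc q
  f = scaledExp n q N
  eq₁ : ∀ a b c d n → a * b * (c * d) * n ≡ a * c * (b * d * n)
  eq₁ = solve-∀
  eq₂ : ∀ n c f → (1 + n) * c * f ≡ c * n * f + c * f
  eq₂ = solve-∀

scaledExp-homogeneous : ∀ n m N → scaledExp n (n * m) N ≡ n ^ N * scaledExp 1 m N
scaledExp-homogeneous n m zero    = sym (*-zeroʳ (n ^ 0))
scaledExp-homogeneous n m (suc N) = begin-equality
  suc N * n * (scaledExp n (n * m) N + (n * m) ^ N)   ≡⟨ cong (suc N * n *_) (cong₂ _+_ (scaledExp-homogeneous n m N) (^-distribʳ-* n m N)) ⟩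
  suc N * n * (n ^ N * scaledExp 1 m N + n ^ N * m ^ N) ≡⟨ eq (suc N) n (n ^ N) (scaledExp 1 m N) (m ^ N) ⟩
  n * n ^ N * (suc N * 1 * (scaledExp 1 m N + m ^ N)) ∎
  where
  eq : ∀ s n p f q → s * n * (p * f + p * q) ≡ n * p * (s * 1 * (f + q))
  eq = solve-∀

[1+1/n]^nm≤e^m : ∀ n m .{{_ : NonZero n}} →
  suc n ^ (n * m) * (suc (n * m)) ! ≤ n ^ (n * m) * scaledExp 1 m (suc (n * m))
[1+1/n]^nm≤e^m n m = *-cancelʳ-≤ _ _ n (begin
  suc n ^ q * (suc q) ! * n             ≤⟨ [1+n]^q≤scaledExp n q ⟩
  scaledExp n q (suc q)                 ≡⟨ scaledExp-homogeneous n m (suc q) ⟩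
  n * n ^ q * scaledExp 1 m (suc q)     ≡⟨ eq n (n ^ q) (scaledExp 1 m (suc q)) ⟩
  n ^ q * scaledExp 1 m (suc q) * n     ∎)
  where
  q = n * m
  eq : ∀ n p f → n * p * f ≡ p * f * n
  eq = solve-∀

-- Counting with lists

private variable
  ℓ ℓ′ ℓ″ : Level
  A : Set ℓ
  B : Set ℓ′
  C′ : Set ℓ″
  k m n : ℕ

length-cartesianProductWith : ∀ (f : A → B → C′) xs ys → length (cartesianProductWith f xs ys) ≡ length xs * length ys
length-cartesianProductWith f []       ys = refl
length-cartesianProductWith f (x ∷ xs) ys = trans (length-++ (map (f x) ys))
  (cong₂ _+_ (length-map (f x) ys) (length-cartesianProductWith f xs ys))

length-concatMap-≤ : ∀ (f : A → List B) xs b → (∀ {x} → x ∈ xs → length (f x) ≤ b) → length (concatMap f xs) ≤ length xs * b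
length-concatMap-≤ f []       b f≤b = z≤n
length-concatMap-≤ f (x ∷ xs) b f≤b = begin
  length (f x ++ concatMap f xs)         ≡⟨ length-++ (f x) ⟩
  length (f x) + length (concatMap f xs) ≤⟨ +-mono-≤ (f≤b (here refl)) (length-concatMap-≤ f xs b (f≤b ∘ there)) ⟩
  b + length xs * b                      ∎

Unique∧⊆⇒length≤ : ∀ {xs ys : List A} → Unique xs → (∀ {x} → x ∈ xs → x ∈ ys) → length xs ≤ length ys
Unique∧⊆⇒length≤ {xs = []} [] xs⊆ys = z≤n
Unique∧⊆⇒length≤ {xs = x ∷ xs} (x∉xs ∷ xs!) xs⊆ys with ∈-∃++ (xs⊆ys (here refl))
... | as , bs , refl = begin
  suc (length xs)              ≤⟨ s≤s (Unique∧⊆⇒length≤ xs! xs⊆as++bs) ⟩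
  suc (length (as ++ bs))      ≡⟨ cong suc (length-++ as) ⟩
  suc (length as + length bs)  ≡⟨ +-suc (length as) (length bs) ⟨
  length as + suc (length bs)  ≡⟨ length-++ as ⟨
  length (as ++ x ∷ bs)        ∎
  where
  xs⊆as++bs : ∀ {y} → y ∈ xs → y ∈ as ++ bs
  xs⊆as++bs y∈xs with ∈-++⁻ as (xs⊆ys (there y∈xs))
  ... | inj₁ y∈as         = ∈-++⁺ˡ y∈as
  ... | inj₂ (here refl)  = contradiction refl (All.lookup x∉xs y∈xs)
  ... | inj₂ (there y∈bs) = ∈-++⁺ʳ as y∈bs

tuples : List A → ∀ m → List (Vec A m)
tuples xs zero    = [] ∷ []
tuples xs (suc m) = cartesianProductWith _∷_ xs (tuples xs m)

length-tuples : ∀ (xs : List A) m → length (tuples xs m) ≡ length xs ^ m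
length-tuples xs zero    = refl
length-tuples xs (suc m) = trans (length-cartesianProductWith _∷_ xs (tuples xs m)) (cong (length xs *_) (length-tuples xs m))

tuples-unique : ∀ {xs : List A} m → Unique xs → Unique (tuples xs m)
tuples-unique zero    xs! = [] ∷ []
tuples-unique (suc m) xs! = Unique.cartesianProductWith⁺ _∷_ (λ { refl → refl , refl }) xs! (tuples-unique m xs!)

∈-tuples : ∀ {xs : List A} (v : Vec A m) → (∀ i → lookup v i ∈ xs) → v ∈ tuples xs m
∈-tuples []      v∈xs = here refl
∈-tuples (x ∷ v) v∈xs = ∈-cartesianProductWith⁺ _∷_ (v∈xs zero) (∈-tuples v (v∈xs ∘ suc))

-- Intervals of values and the shift made by `punchIn`

interval : ∀ n → ℕ → ℕ → List (Fin n)
interval n a zero    = []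
interval n a (suc l) with a <? n
... | yes a<n = fromℕ< a<n ∷ interval n (suc a) l
... | no  _   = []

∈-interval⁺ : ∀ {n a l} {c : Fin n} → a ≤ toℕ c → toℕ c < a + l → c ∈ interval n a l
∈-interval⁺ {n} {a} {zero} {c} a≤c c<a+l = contradiction (≤-<-trans a≤c c<a+l) (<-irrefl (sym (+-identityʳ a)))
∈-interval⁺ {n} {a} {suc l} {c} a≤c c<a+l with a <? n
... | no a≮n  = contradiction (≤-<-trans a≤c (toℕ<n c)) a≮n
... | yes a<n with m≤n⇒m<n∨m≡n a≤c
...   | inj₁ a<c  = there (∈-interval⁺ a<c (subst (toℕ c <_) (+-suc a l) c<a+l))
...   | inj₂ a≡c  = here (toℕ-injective (trans (sym a≡c) (sym (toℕ-fromℕ< a<n))))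

∈-interval⁻ : ∀ {n a l} {c : Fin n} → c ∈ interval n a l → a ≤ toℕ c × toℕ c < a + l
∈-interval⁻ {n} {a} {suc l} {c} c∈ with a <? n
∈-interval⁻ {n} {a} {suc l} {c} (here refl) | yes a<n =
  ≤-reflexive (sym (toℕ-fromℕ< a<n)) , subst (_< a + suc l) (sym (toℕ-fromℕ< a<n)) (m<m+n a z<s)
∈-interval⁻ {n} {a} {suc l} {c} (there c∈) | yes a<n with ∈-interval⁻ {a = suc a} {l} c∈
... | a<c , c<a+l = <⇒≤ a<c , subst (toℕ c <_) (sym (+-suc a l)) c<a+l

length-interval : ∀ {n} a l → a + l ≤ n → length (interval n a l) ≡ l
length-interval a zero    _ = refl
length-interval {n} a (suc l) a+l≤n with a <? n
... | yes a<n = cong suc (length-interval (suc a) l (subst (_≤ n) (+-suc a l) a+l≤n))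
... | no a≮n  = contradiction (≤-trans (m<m+n a z<s) a+l≤n) a≮n

interval-unique : ∀ n a l → Unique (interval n a l)
interval-unique n a zero = []
interval-unique n a (suc l) with a <? n
... | yes a<n = All.tabulate (λ c∈ a≡c → <-irrefl (trans (sym (toℕ-fromℕ< a<n)) (cong toℕ a≡c)) (proj₁ (∈-interval⁻ {a = suc a} {l} c∈)))
              ∷ interval-unique n (suc a) l
... | no  _   = []

toℕ-punchIn-≥ : ∀ (c : Fin (suc n)) x → toℕ c ≤ toℕ x → toℕ (punchIn c x) ≡ suc (toℕ x)
toℕ-punchIn-≥ zero    x       _         = refl
toℕ-punchIn-≥ (suc c) (suc x) (s≤s c≤x) = cong suc (toℕ-punchIn-≥ c x c≤x)

toℕ-punchIn-< : ∀ (c : Fin (suc n)) x → toℕ x < toℕ c → toℕ (punchIn c x) ≡ toℕ x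
toℕ-punchIn-< (suc c) zero    _         = refl
toℕ-punchIn-< (suc c) (suc x) (s≤s x<c) = cong suc (toℕ-punchIn-< c x x<c)

toℕ-punchIn-bounds : ∀ (c : Fin (suc n)) x → toℕ x ≤ toℕ (punchIn c x) × toℕ (punchIn c x) ≤ suc (toℕ x)
toℕ-punchIn-bounds c x with toℕ x <? toℕ c
... | yes x<c rewrite toℕ-punchIn-< c x x<c        = ≤-refl , n≤1+n _
... | no  x≮c rewrite toℕ-punchIn-≥ c x (≮⇒≥ x≮c)  = n≤1+n _ , ≤-refl

punchIn<c⇒x<c : ∀ (c : Fin (suc n)) x → toℕ (punchIn c x) < toℕ c → toℕ x < toℕ c
punchIn<c⇒x<c c x px<c = ≤-<-trans (proj₁ (toℕ-punchIn-bounds c x)) px<c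

-- Lehmer codes of the permutations of Fin n.
infixr 5 _∷_
data Code : ℕ → Set where
  []  : Code 0
  _∷_ : Fin (suc n) → Code n → Code (suc n)

perm : Code n → Fin n → Fin n
perm (c ∷ cs) zero    = c
perm (c ∷ cs) (suc i) = punchIn c (perm cs i)

perm-injective : ∀ (cs : Code n) {i j} → perm cs i ≡ perm cs j → i ≡ j
perm-injective (c ∷ cs) {zero}  {zero}  eq = refl
perm-injective (c ∷ cs) {zero}  {suc j} eq = contradiction (sym eq) (punchInᵢ≢i c (perm cs j))
perm-injective (c ∷ cs) {suc i} {zero}  eq = contradiction eq (punchInᵢ≢i c (perm cs i))
perm-injective (c ∷ cs) {suc i} {suc j} eq = cong suc (perm-injective cs (punchIn-injective c _ _ eq))

perm-faithful : ∀ (cs ds : Code n) → (∀ i → perm cs i ≡ perm ds i) → cs ≡ ds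
perm-faithful []       []       eq = refl
perm-faithful (c ∷ cs) (d ∷ ds) eq with eq zero
... | refl = cong (c ∷_) (perm-faithful cs ds (λ i → punchIn-injective c _ _ (eq (suc i))))

-- Rank classes and the permutations compatible with them

module _ {P : Pred ℕ ℓ} (P? : Decidable P) where

  count-∷-yes : ∀ {x} (xs : Vec ℕ n) → P x → count P? (x ∷ xs) ≡ suc (count P? xs)
  count-∷-yes {x = x} xs px with P? x
  ... | yes _  = refl
  ... | no ¬px = contradiction px ¬px

  count-∷-no : ∀ {x} (xs : Vec ℕ n) → ¬ P x → count P? (x ∷ xs) ≡ count P? xs
  count-∷-no {x = x} xs ¬px with P? x
  ... | yes px = contradiction px ¬px
  ... | no _   = refl

module _ {P Q : Pred ℕ ℓ} (P? : Decidable P) (Q? : Decidable Q) where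

  count-mono : (∀ {x} → P x → Q x) → (xs : Vec ℕ n) → count P? xs ≤ count Q? xs
  count-mono P⊆Q [] = z≤n
  count-mono P⊆Q (x ∷ xs) with P? x | Q? x
  ... | yes _  | yes _  = s≤s (count-mono P⊆Q xs)
  ... | yes px | no ¬qx = contradiction (P⊆Q px) ¬qx
  ... | no _   | yes _  = m≤n⇒m≤1+n (count-mono P⊆Q xs)
  ... | no _   | no _   = count-mono P⊆Q xs

module _ {P Q R : Pred ℕ ℓ} (P? : Decidable P) (Q? : Decidable Q) (R? : Decidable R) where

  count-⊎ : (∀ {x} → R x → P x ⊎ Q x) → (∀ {x} → P x → R x) → (∀ {x} → Q x → R x) → (∀ {x} → P x → ¬ Q x) →
            (xs : Vec ℕ n) → count P? xs + count Q? xs ≡ count R? xs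
  count-⊎ split P⊆R Q⊆R disj [] = refl
  count-⊎ split P⊆R Q⊆R disj (x ∷ xs) with P? x | Q? x | R? x
  ... | yes px | yes qx | _      = contradiction qx (disj px)
  ... | yes _  | no _   | yes _  = cong suc (count-⊎ split P⊆R Q⊆R disj xs)
  ... | yes px | no _   | no ¬rx = contradiction (P⊆R px) ¬rx
  ... | no _   | yes _  | yes _  = trans (+-suc _ _) (cong suc (count-⊎ split P⊆R Q⊆R disj xs))
  ... | no _   | yes qx | no ¬rx = contradiction (Q⊆R qx) ¬rx
  ... | no ¬px | no ¬qx | yes rx = contradiction (split rx) [ ¬px , ¬qx ]
  ... | no _   | no _   | no _   = count-⊎ split P⊆R Q⊆R disj xs

count-<+≟ : ∀ t (r : Vec ℕ n) → count (t <?_) r + count (t ≟_) r ≡ count (t ≤?_) r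
count-<+≟ t = count-⊎ (t <?_) (t ≟_) (t ≤?_) m≤n⇒m<n∨m≡n <⇒≤ ≤-reflexive <⇒≢

-- The permutations σ with r i > r j ⇒ σ i < σ j: the indices of rank t fill the
-- interval of values following those taken by the indices of larger rank.
extensions : Vec ℕ n → List (Code n)
extensions []                = [] ∷ []
extensions {suc n} (t ∷ r) = cartesianProductWith _∷_ (interval (suc n) (count (t <?_) r) (suc (count (t ≟_) r))) (extensions r)

extensions-unique : ∀ (r : Vec ℕ n) → Unique (extensions r)
extensions-unique []      = [] ∷ []
extensions-unique (t ∷ r) = Unique.cartesianProductWith⁺ _∷_ (λ { refl → refl , refl }) (interval-unique _ (count (t <?_) r) (suc (count (t ≟_) r))) (extensions-unique r)

-- Each rank owns a block of consecutive values, and larger ranks own lower blocks. Punching in a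
-- head of rank `t` inside its own block lengthens that block by one, moves the blocks of smaller
-- ranks up by one and leaves those of larger ranks in place; these are the three cases of `<-cmp`.
∈-extensions⁻ : ∀ (r : Vec ℕ n) {cs} → cs ∈ extensions r → ∀ i →
  count (lookup r i <?_) r ≤ toℕ (perm cs i) × toℕ (perm cs i) < count (lookup r i ≤?_) r
∈-extensions⁻ {suc n} (t ∷ r) cs∈ i with ∈-cartesianProductWith⁻ _∷_ (interval (suc n) (count (t <?_) r) (suc (count (t ≟_) r))) (extensions r) cs∈
... | c , cs , c∈ , cs∈′ , refl = go i
  where
  c-bounds = ∈-interval⁻ {a = count (t <?_) r} c∈
  c≤ : toℕ c ≤ count (t ≤?_) r
  c≤ = s≤s⁻¹ (subst (toℕ c <_) (trans (+-suc _ _) (cong suc (count-<+≟ t r))) (proj₂ c-bounds))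
  go : ∀ i → count (lookup (t ∷ r) i <?_) (t ∷ r) ≤ toℕ (perm (c ∷ cs) i) × toℕ (perm (c ∷ cs) i) < count (lookup (t ∷ r) i ≤?_) (t ∷ r)
  go zero = ≤-trans (≤-reflexive (count-∷-no (t <?_) r (<-irrefl refl))) (proj₁ c-bounds)
          , subst (toℕ c <_) (sym (count-∷-yes (t ≤?_) r ≤-refl)) (s≤s c≤)
  go (suc i) with lookup r i | ∈-extensions⁻ r cs∈′ i
  ... | s | lo , hi with <-cmp s t
  ... | tri< s<t _ _ rewrite count-∷-yes (s <?_) r s<t | count-∷-yes (s ≤?_) r (<⇒≤ s<t)
                           | toℕ-punchIn-≥ c (perm cs i) (≤-trans c≤ (≤-trans (count-mono (t ≤?_) (s <?_) (<-≤-trans s<t) r) lo))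
                           = s≤s lo , s≤s hi
  ... | tri≈ _ refl _ rewrite count-∷-no (t <?_) r (<-irrefl refl) | count-∷-yes (t ≤?_) r ≤-refl
                           = ≤-trans lo (proj₁ (toℕ-punchIn-bounds c (perm cs i)))
                           , s≤s (≤-trans (proj₂ (toℕ-punchIn-bounds c (perm cs i))) hi)
  ... | tri> _ _ t<s rewrite count-∷-no (s <?_) r (<-asym t<s) | count-∷-no (s ≤?_) r (<⇒≱ t<s)
                           | toℕ-punchIn-< c (perm cs i) (<-≤-trans hi (≤-trans (count-mono (s ≤?_) (t <?_) (<-≤-trans t<s) r) (proj₁ c-bounds)))
                           = lo , hi

extensions-antitone : ∀ (r : Vec ℕ n) {cs} → cs ∈ extensions r → ∀ i j → lookup r j < lookup r i → toℕ (perm cs i) < toℕ (perm cs j)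
extensions-antitone r cs∈ i j rj<ri = <-≤-trans (proj₂ (∈-extensions⁻ r cs∈ i))
  (≤-trans (count-mono (lookup r i ≤?_) (lookup r j <?_) (<-≤-trans rj<ri) r) (proj₁ (∈-extensions⁻ r cs∈ j)))

-- When all ranks are below `L`, `n !` divided by this is the multinomial coefficient of the rank
-- classes.
multiplicity! : ℕ → Vec ℕ n → ℕ
multiplicity! zero    r = 1
multiplicity! (suc L) r = (count (L ≟_) r) ! * multiplicity! L r

multiplicity!-∷-≥ : ∀ L t (r : Vec ℕ n) → L ≤ t → multiplicity! L (t ∷ r) ≡ multiplicity! L r
multiplicity!-∷-≥ zero    t r _   = refl
multiplicity!-∷-≥ (suc L) t r L<t = cong₂ (λ x y → x ! * y) (count-∷-no (L ≟_) r (<⇒≢ L<t)) (multiplicity!-∷-≥ L t r (<⇒≤ L<t))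

multiplicity!-∷-< : ∀ L t (r : Vec ℕ n) → t < L → multiplicity! L (t ∷ r) ≡ suc (count (t ≟_) r) * multiplicity! L r
multiplicity!-∷-< (suc L) t r t<1+L with m≤n⇒m<n∨m≡n (s≤s⁻¹ t<1+L)
... | inj₁ t<L = trans (cong₂ (λ x y → x ! * y) (count-∷-no (L ≟_) r (<⇒≢ t<L ∘ sym)) (multiplicity!-∷-< L t r t<L))
                       (eq ((count (L ≟_) r) !) (suc (count (t ≟_) r)) (multiplicity! L r))
  where
  eq : ∀ x y z → x * (y * z) ≡ y * (x * z)
  eq = solve-∀
... | inj₂ refl = trans (cong₂ (λ x y → x ! * y) (count-∷-yes (t ≟_) r refl) (multiplicity!-∷-≥ L t r ≤-refl))
                        (*-assoc (suc (count (t ≟_) r)) ((count (t ≟_) r) !) (multiplicity! t r))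

length-extensions : ∀ {L} (r : Vec ℕ n) → (∀ i → lookup r i < L) → length (extensions r) ≡ multiplicity! L r
length-extensions {L = L} [] r<L = sym (multiplicity!-[] L)
  where
  multiplicity!-[] : ∀ L → multiplicity! L [] ≡ 1
  multiplicity!-[] zero    = refl
  multiplicity!-[] (suc L) = trans (+-identityʳ _) (multiplicity!-[] L)
length-extensions {suc n} {L} (t ∷ r) r<L = begin-equality
  length (extensions (t ∷ r))                               ≡⟨ length-cartesianProductWith _∷_ (interval (suc n) (count (t <?_) r) (suc (count (t ≟_) r))) (extensions r) ⟩
  length (interval (suc n) (count (t <?_) r) (suc (count (t ≟_) r))) * length (extensions r)
    ≡⟨ cong₂ _*_ (length-interval (count (t <?_) r) (suc (count (t ≟_) r)) fits) (length-extensions r (r<L ∘ suc)) ⟩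
  suc (count (t ≟_) r) * multiplicity! L r                  ≡⟨ multiplicity!-∷-< L t r (r<L zero) ⟨
  multiplicity! L (t ∷ r)                                   ∎
  where
  fits : count (t <?_) r + suc (count (t ≟_) r) ≤ suc n
  fits = subst (_≤ suc n) (sym (trans (+-suc _ _) (cong suc (count-<+≟ t r)))) (s≤s (count≤n (t ≤?_) r))

count<0≡0 : ∀ (r : Vec ℕ n) → count (_<? 0) r ≡ 0
count<0≡0 []      = refl
count<0≡0 (x ∷ r) = count<0≡0 r

-- A multinomial coefficient is one term of the expansion of (1 + ... + 1)ⁿ with `L` summands. The
-- induction splits off the class of the top rank as a binomial coefficient.
count<! : ∀ L (r : Vec ℕ n) → (count (_<? L) r) ! ≤ L ^ count (_<? L) r * multiplicity! L r
count<! zero r rewrite count<0≡0 r = ≤-refl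
count<! (suc L) r = *-cancelʳ-≤ _ _ (L ^ lt) {{L^lt≢0 L r}} (begin
  (count (_<? suc L) r) ! * L ^ lt            ≡⟨ cong (λ x → x ! * L ^ lt) split ⟩
  (eq + lt) ! * L ^ lt                        ≤⟨ [a+b]!*L^b≤[1+L]^[a+b]*a!*b! L eq lt ⟩
  suc L ^ (eq + lt) * (eq ! * lt !)           ≤⟨ *-monoʳ-≤ (suc L ^ (eq + lt)) (*-monoʳ-≤ (eq !) (count<! L r)) ⟩
  suc L ^ (eq + lt) * (eq ! * (L ^ lt * multiplicity! L r)) ≡⟨ assoc (suc L ^ (eq + lt)) (eq !) (L ^ lt) (multiplicity! L r) ⟩
  suc L ^ (eq + lt) * multiplicity! (suc L) r * L ^ lt ≡⟨ cong (λ x → suc L ^ x * multiplicity! (suc L) r * L ^ lt) split ⟨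
  suc L ^ count (_<? suc L) r * multiplicity! (suc L) r * L ^ lt ∎)
  where
  eq = count (L ≟_) r
  lt = count (_<? L) r
  split : count (_<? suc L) r ≡ eq + lt
  split = sym (count-⊎ (L ≟_) (_<? L) (_<? suc L)
    (λ x<1+L → [ inj₂ , inj₁ ∘ sym ] (m≤n⇒m<n∨m≡n (s≤s⁻¹ x<1+L)))
    (λ { refl → ≤-refl }) m<n⇒m<1+n (λ { refl → <-irrefl refl }) r)
  L^lt≢0 : ∀ L {n} (r : Vec ℕ n) → NonZero (L ^ count (_<? L) r)
  -- No rank is below 0, so for `L = 0` the power is `0 ^ 0`, which is 1 and may be cancelled.
  L^lt≢0 zero    r rewrite count<0≡0 r = _
  L^lt≢0 (suc L) r       = m^n≢0 (suc L) (count (_<? suc L) r)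
  assoc : ∀ a b c d → a * (b * (c * d)) ≡ a * (b * d) * c
  assoc = solve-∀

n!≤L^n*extensions : ∀ L (r : Vec ℕ n) → (∀ i → lookup r i < L) → n ! ≤ L ^ n * length (extensions r)
n!≤L^n*extensions {n} L r r<L = begin
  n !                                              ≡⟨ cong _! (all-counted r r<L) ⟨
  (count (_<? L) r) !                              ≤⟨ count<! L r ⟩
  L ^ count (_<? L) r * multiplicity! L r          ≡⟨ cong₂ (λ x y → L ^ x * y) (all-counted r r<L) (sym (length-extensions r r<L)) ⟩
  L ^ n * length (extensions r)                    ∎
  where
  all-counted : ∀ {n} (r : Vec ℕ n) → (∀ i → lookup r i < L) → count (_<? L) r ≡ n
  all-counted []      r<L = refl
  all-counted (t ∷ r) r<L = trans (count-∷-yes (_<? L) r (r<L zero)) (cong suc (all-counted r (r<L ∘ suc)))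

-- Permutations decreasing on a given set of indices

DecreasingOn : Subset n → Code n → Set
DecreasingOn S cs = ∀ {i j} → toℕ i < toℕ j → i ∈ˢ S → j ∈ˢ S → toℕ (perm cs j) < toℕ (perm cs i)

-- The bound `u` on the values taken on `S` is the state of the recursion. A head in `S` becomes the
-- new bound. A head outside `S` either occupies one of the values below `u`, leaving `pred u` of
-- them, or leaves all `u`.
decreasingBelow : Subset n → ℕ → List (Code n)
decreasingBelow [] u = [] ∷ []
decreasingBelow {suc n} (inside ∷ S) u = concatMap (λ c → map (c ∷_) (decreasingBelow S (toℕ c))) (interval (suc n) 0 u)
decreasingBelow {suc n} (outside ∷ S) u =
  cartesianProductWith _∷_ (interval (suc n) 0 u) (decreasingBelow S (pred u)) ++
  cartesianProductWith _∷_ (interval (suc n) u (suc n ∸ u)) (decreasingBelow S u)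

DecreasingOn-tail : ∀ {s S} (c : Fin (suc n)) {cs} → DecreasingOn (s ∷ S) (c ∷ cs) → DecreasingOn S cs
DecreasingOn-tail c {cs} dec {i} {j} i<j i∈S j∈S = ≰⇒>
  (λ pᵢ≤pⱼ → <⇒≱ (dec (s<s i<j) (there i∈S) (there j∈S)) (punchIn-mono-≤ c (perm cs i) (perm cs j) pᵢ≤pⱼ))

∈-decreasingBelow : ∀ (S : Subset n) {u} cs → (∀ {i} → i ∈ˢ S → toℕ (perm cs i) < u) → DecreasingOn S cs → cs ∈ decreasingBelow S u
∈-decreasingBelow []            []       below dec = here refl
∈-decreasingBelow (inside ∷ S)  {u} (c ∷ cs) below dec =
  ∈-concatMap⁺ (λ c → map (c ∷_) (decreasingBelow S (toℕ c)))
    (Any.map (λ { refl → ∈-map⁺ (c ∷_) (∈-decreasingBelow S cs below-c (DecreasingOn-tail c dec)) }) (∈-interval⁺ {l = u} z≤n (below here)))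
  where
  below-c : ∀ {i} → i ∈ˢ S → toℕ (perm cs i) < toℕ c
  below-c i∈S = punchIn<c⇒x<c c _ (dec z<s here (there i∈S))
∈-decreasingBelow {suc n} (outside ∷ S) {u} (c ∷ cs) below dec with toℕ c <? u
... | yes c<u = ∈-++⁺ˡ (∈-cartesianProductWith⁺ _∷_ (∈-interval⁺ {l = u} z≤n c<u) (∈-decreasingBelow S cs below-pred (DecreasingOn-tail c dec)))
  where
  below-pred : ∀ {i} → i ∈ˢ S → toℕ (perm cs i) < pred u
  below-pred {i} i∈S with toℕ (perm cs i) <? toℕ c
  ... | yes x<c = <-≤-trans x<c (<⇒≤pred c<u)
  ... | no  x≮c = <⇒≤pred (subst (_< u) (toℕ-punchIn-≥ c (perm cs i) (≮⇒≥ x≮c)) (below (there i∈S)))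
... | no c≮u = ∈-++⁺ʳ (cartesianProductWith _∷_ (interval (suc n) 0 u) (decreasingBelow S (pred u)))
  (∈-cartesianProductWith⁺ _∷_ (∈-interval⁺ (≮⇒≥ c≮u) (<-≤-trans (toℕ<n c) (m≤n+m∸n (suc n) u)))
    (∈-decreasingBelow S cs (λ {i} i∈S → ≤-<-trans (proj₁ (toℕ-punchIn-bounds c (perm cs i))) (below (there i∈S))) (DecreasingOn-tail c dec)))

-- The hockey-stick identity for the sum of C(c, k) over a ≤ c < a + l, with C(a, k + 1) moved to
-- the left in place of a subtraction.
∑-interval-C : ∀ {A : Set} (f : Fin n → List A) b k → (∀ c → length (f c) ≤ b * (toℕ c C k)) → ∀ a l → a + l ≤ n →
               length (concatMap f (interval n a l)) + b * (a C suc k) ≤ b * ((a + l) C suc k)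
∑-interval-C f b k f≤ a zero a+l≤n = ≤-reflexive (cong (λ x → b * (x C suc k)) (sym (+-identityʳ a)))
∑-interval-C {n} f b k f≤ a (suc l) a+l≤n with a <? n
... | no a≮n  = contradiction (≤-trans (m<m+n a z<s) a+l≤n) a≮n
... | yes a<n = begin
  length (f c ++ rest) + b * (a C suc k)                ≡⟨ cong (_+ b * (a C suc k)) (length-++ (f c)) ⟩
  length (f c) + length rest + b * (a C suc k)          ≤⟨ +-monoˡ-≤ (b * (a C suc k)) (+-monoˡ-≤ (length rest) (subst (λ x → length (f c) ≤ b * (x C k)) (toℕ-fromℕ< a<n) (f≤ c))) ⟩
  b * (a C k) + length rest + b * (a C suc k)           ≡⟨ eq b (a C k) (length rest) (a C suc k) ⟩
  length rest + b * (a C k + a C suc k)                 ≡⟨ cong (λ x → length rest + b * x) (nCk+nC[k+1]≡[n+1]C[k+1] a k) ⟩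
  length rest + b * (suc a C suc k)                     ≤⟨ ∑-interval-C f b k f≤ (suc a) l (subst (_≤ n) (+-suc a l) a+l≤n) ⟩
  b * (suc (a + l) C suc k)                             ≡⟨ cong (λ x → b * (x C suc k)) (+-suc a l) ⟨
  b * ((a + suc l) C suc k)                             ∎
  where
  c = fromℕ< a<n
  rest = concatMap f (interval n (suc a) l)
  eq : ∀ b x r y → b * x + r + b * y ≡ r + b * (x + y)
  eq = solve-∀

-- The identity u C(u-1, k) = (u - k) C(u, k) in additive form, since `u ∸ k` would truncate.
u*[u-1]Ck+k*uCk≡u*uCk : ∀ u k → u * (pred u C k) + k * (u C k) ≡ u * (u C k)
u*[u-1]Ck+k*uCk≡u*uCk zero zero = refl
u*[u-1]Ck+k*uCk≡u*uCk zero (suc k) = trans (cong (suc k *_) (k>n⇒nCk≡0 {0} {suc k} z<s)) (*-zeroʳ (suc k))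
u*[u-1]Ck+k*uCk≡u*uCk (suc u) zero = +-identityʳ _
u*[u-1]Ck+k*uCk≡u*uCk (suc u) (suc k) = begin-equality
  suc u * (u C suc k) + suc k * (suc u C suc k)   ≡⟨ cong (suc u * (u C suc k) +_) ([1+k]*[1+n]C[1+k]≡[1+n]*nCk u k) ⟩
  suc u * (u C suc k) + suc u * (u C k)           ≡⟨ *-distribˡ-+ (suc u) (u C suc k) (u C k) ⟨
  suc u * (u C suc k + u C k)                     ≡⟨ cong (suc u *_) (trans (+-comm (u C suc k) (u C k)) (nCk+nC[k+1]≡[n+1]C[k+1] u k)) ⟩
  suc u * (suc u C suc k)                         ∎

-- Choosing the set of values on `S` among the `u` smallest fixes the permutation there, and the `m`
-- other indices can be filled in `m !` ways. In the recursion a head in `S` gives a hockey-stick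
-- sum; a head outside `S` gives `choices`, a factor `suc m`.
length-decreasingBelow : ∀ (S : Subset n) m u → ∣ S ∣ + m ≡ n → u ≤ n → length (decreasingBelow S u) ≤ m ! * (u C ∣ S ∣)
length-decreasingBelow [] zero zero refl z≤n = ≤-refl
length-decreasingBelow {suc n} (inside ∷ S) m u eq u≤n = begin
  length (concatMap f (interval (suc n) 0 u))                             ≤⟨ m≤m+n _ (m ! * (0 C suc ∣ S ∣)) ⟩
  length (concatMap f (interval (suc n) 0 u)) + m ! * (0 C suc ∣ S ∣)     ≤⟨ ∑-interval-C f (m !) ∣ S ∣ f≤ 0 u u≤n ⟩
  m ! * (u C suc ∣ S ∣)                                                   ∎
  where
  f : Fin (suc n) → List (Code (suc n))
  f c = map (c ∷_) (decreasingBelow S (toℕ c))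
  f≤ : ∀ c → length (f c) ≤ m ! * (toℕ c C ∣ S ∣)
  f≤ c = ≤-trans (≤-reflexive (length-map (c ∷_) (decreasingBelow S (toℕ c))))
    (length-decreasingBelow S m (toℕ c) (suc-injective eq) (toℕ≤pred[n] c))
length-decreasingBelow (outside ∷ S) zero u eq u≤n = contradiction (∣p∣≤n S) (<⇒≱ (≤-reflexive (sym (trans (sym (+-identityʳ ∣ S ∣)) eq))))
length-decreasingBelow {suc n} (outside ∷ S) (suc m) u eq u≤1+n = begin
  length (cartesianProductWith _∷_ lower (decreasingBelow S (pred u)) ++ cartesianProductWith _∷_ upper (decreasingBelow S u))
    ≡⟨ length-++ (cartesianProductWith _∷_ lower (decreasingBelow S (pred u))) ⟩
  length (cartesianProductWith _∷_ lower (decreasingBelow S (pred u))) + length (cartesianProductWith _∷_ upper (decreasingBelow S u))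
    ≡⟨ cong₂ _+_ (length-cartesianProductWith _∷_ lower (decreasingBelow S (pred u))) (length-cartesianProductWith _∷_ upper (decreasingBelow S u)) ⟩
  length lower * length (decreasingBelow S (pred u)) + length upper * length (decreasingBelow S u)
    ≡⟨ cong₂ (λ x y → x * length (decreasingBelow S (pred u)) + y * length (decreasingBelow S u))
         (length-interval 0 u u≤1+n) (length-interval u (suc n ∸ u) (≤-reflexive (m+[n∸m]≡n u≤1+n))) ⟩
  u * length (decreasingBelow S (pred u)) + (suc n ∸ u) * length (decreasingBelow S u)
    ≤⟨ +-mono-≤ (*-monoʳ-≤ u (length-decreasingBelow S m (pred u) ∣S∣+m≡n (pred-mono-≤ u≤1+n))) upper≤ ⟩
  u * (m ! * (pred u C K)) + (suc n ∸ u) * (m ! * (u C K))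
    ≡⟨ regroup u (m !) (pred u C K) (suc n ∸ u) (u C K) ⟩
  m ! * (u * (pred u C K) + (suc n ∸ u) * (u C K))
    ≡⟨ cong (m ! *_) choices ⟩
  m ! * (suc m * (u C K))
    ≡⟨ regroup′ (m !) (suc m) (u C K) ⟩
  suc m * m ! * (u C K) ∎
  where
  K = ∣ S ∣
  lower = interval (suc n) 0 u
  upper = interval (suc n) u (suc n ∸ u)
  ∣S∣+m≡n : ∣ S ∣ + m ≡ n
  ∣S∣+m≡n = suc-injective (trans (sym (+-suc K m)) eq)
  upper≤ : (suc n ∸ u) * length (decreasingBelow S u) ≤ (suc n ∸ u) * (m ! * (u C K))
  upper≤ with m≤n⇒m<n∨m≡n u≤1+n
  ... | inj₁ u<1+n = *-monoʳ-≤ (suc n ∸ u) (length-decreasingBelow S m u ∣S∣+m≡n (s≤s⁻¹ u<1+n))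
  -- At `u = suc n` the induction hypothesis does not apply, but no head lies at or above `u`.
  ... | inj₂ refl rewrite n∸n≡0 n = z≤n
  regroup : ∀ u f x v y → u * (f * x) + v * (f * y) ≡ f * (u * x + v * y)
  regroup = solve-∀
  regroup′ : ∀ f s x → f * (s * x) ≡ s * f * x
  regroup′ = solve-∀
  regroup₁ : ∀ x y z → x + y + z ≡ x + z + y
  regroup₁ = solve-∀
  choices : u * (pred u C K) + (suc n ∸ u) * (u C K) ≡ suc m * (u C K)
  choices = +-cancelʳ-≡ (K * (u C K)) _ _ (begin-equality
    u * (pred u C K) + (suc n ∸ u) * (u C K) + K * (u C K) ≡⟨ regroup₁ (u * (pred u C K)) ((suc n ∸ u) * (u C K)) (K * (u C K)) ⟩
    u * (pred u C K) + K * (u C K) + (suc n ∸ u) * (u C K) ≡⟨ cong (_+ (suc n ∸ u) * (u C K)) (u*[u-1]Ck+k*uCk≡u*uCk u K) ⟩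
    u * (u C K) + (suc n ∸ u) * (u C K)                    ≡⟨ *-distribʳ-+ (u C K) u (suc n ∸ u) ⟨
    (u + (suc n ∸ u)) * (u C K)                            ≡⟨ cong (_* (u C K)) (m+[n∸m]≡n u≤1+n) ⟩
    suc n * (u C K)                                        ≡⟨ cong (_* (u C K)) (trans (sym eq) (+-comm K (suc m))) ⟩
    (suc m + K) * (u C K)                                  ≡⟨ *-distribʳ-+ (u C K) (suc m) K ⟩
    suc m * (u C K) + K * (u C K)                          ∎)

-- Union bound for the tuples with a chain of size `k`

subsets : (n k : ℕ) → List (Subset n)
subsets zero    zero    = [] ∷ []
subsets zero    (suc k) = []
subsets (suc n) zero    = map (outside ∷_) (subsets n zero)
subsets (suc n) (suc k) = map (inside ∷_) (subsets n k) ++ map (outside ∷_) (subsets n (suc k))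

length-subsets : ∀ n k → length (subsets n k) ≡ n C k
length-subsets zero    zero    = refl
length-subsets zero    (suc k) = sym (k>n⇒nCk≡0 {0} {suc k} z<s)
length-subsets (suc n) zero    = trans (length-map (outside ∷_) (subsets n zero)) (length-subsets n zero)
length-subsets (suc n) (suc k) = begin-equality
  length (map (inside ∷_) (subsets n k) ++ map (outside ∷_) (subsets n (suc k)))         ≡⟨ length-++ (map (inside ∷_) (subsets n k)) ⟩
  length (map (inside ∷_) (subsets n k)) + length (map (outside ∷_) (subsets n (suc k))) ≡⟨ cong₂ _+_ (length-map (inside ∷_) (subsets n k)) (length-map (outside ∷_) (subsets n (suc k))) ⟩
  length (subsets n k) + length (subsets n (suc k))                                      ≡⟨ cong₂ _+_ (length-subsets n k) (length-subsets n (suc k)) ⟩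
  n C k + n C suc k                                                                      ≡⟨ nCk+nC[k+1]≡[n+1]C[k+1] n k ⟩
  suc n C suc k                                                                          ∎

∈-subsets⁺ : ∀ (S : Subset n) → S ∈ subsets n ∣ S ∣
∈-subsets⁺ []            = here refl
∈-subsets⁺ (inside ∷ S)  = ∈-++⁺ˡ (∈-map⁺ (inside ∷_) (∈-subsets⁺ S))
∈-subsets⁺ {suc n} (outside ∷ S) with ∣ S ∣ | ∈-subsets⁺ S
... | zero  | S∈ = ∈-map⁺ (outside ∷_) S∈
... | suc k | S∈ = ∈-++⁺ʳ (map (inside ∷_) (subsets n k)) (∈-map⁺ (outside ∷_) S∈)

∈-subsets⁻ : ∀ n k {S} → S ∈ subsets n k → ∣ S ∣ ≡ k
∈-subsets⁻ zero    zero    (here refl) = refl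
∈-subsets⁻ (suc n) zero    S∈ with ∈-map⁻ (outside ∷_) S∈
... | S , S∈′ , refl = ∈-subsets⁻ n zero S∈′
∈-subsets⁻ (suc n) (suc k) S∈ with ∈-++⁻ (map (inside ∷_) (subsets n k)) S∈
... | inj₁ S∈ˡ with ∈-map⁻ (inside ∷_) S∈ˡ
...   | S , S∈′ , refl = cong suc (∈-subsets⁻ n k S∈′)
∈-subsets⁻ (suc n) (suc k) S∈ | inj₂ S∈ʳ with ∈-map⁻ (outside ∷_) S∈ʳ
...   | S , S∈′ , refl = ∈-subsets⁻ n (suc k) S∈′

-- A tuple with several chains of size `k` appears once for each; repetitions are harmless in a list
-- that serves only as an upper bound.
chainTuples : ∀ n m k → List (Vec (Code n) m)
chainTuples n m k = concatMap (λ S → tuples (decreasingBelow S n) m) (subsets n k)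

∈-chainTuples : ∀ (S : Subset n) (v : Vec (Code n) m) → (∀ l → DecreasingOn S (lookup v l)) → v ∈ chainTuples n m ∣ S ∣
∈-chainTuples {n} {m} S v dec = ∈-concatMap⁺ (λ S → tuples (decreasingBelow S n) m)
  (Any.map (λ { refl → ∈-tuples v (λ l → ∈-decreasingBelow S (lookup v l) (λ {i} _ → toℕ<n (perm (lookup v l) i)) (dec l)) }) (∈-subsets⁺ S))

length-chainTuples : ∀ n m k → length (chainTuples n m k) ≤ (n C k) * ((n ∸ k) ! * (n C k)) ^ m
length-chainTuples n m k = ≤-trans (length-concatMap-≤ (λ S → tuples (decreasingBelow S n) m) (subsets n k) _ bound)
  (≤-reflexive (cong (_* ((n ∸ k) ! * (n C k)) ^ m) (length-subsets n k)))
  where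
  bound : ∀ {S} → S ∈ subsets n k → length (tuples (decreasingBelow S n) m) ≤ ((n ∸ k) ! * (n C k)) ^ m
  bound {S} S∈ with ∈-subsets⁻ n k S∈
  ... | refl = ≤-trans (≤-reflexive (length-tuples (decreasingBelow S n) m))
    (^-monoˡ-≤ m (length-decreasingBelow S (n ∸ ∣ S ∣) n (m+[n∸m]≡n (∣p∣≤n S)) ≤-refl))

[n∸k]!*nCk*k!≤n! : ∀ n k → (n ∸ k) ! * (n C k) * k ! ≤ n !
[n∸k]!*nCk*k!≤n! n k with k ≤? n
... | no k≰n rewrite k>n⇒nCk≡0 (≰⇒> k≰n) | *-zeroʳ ((n ∸ k) !) = z≤n
... | yes k≤n with m≤n⇒∃[o]m+o≡n k≤n
...   | m , refl = ≤-reflexive (trans (cong (λ x → x ! * ((k + m) C k) * k !) (m+n∸m≡n k m)) (trans (eq (m !) ((k + m) C k) (k !)) ([k+m]Ck*k!*m!≡[k+m]! k m)))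
  where
  eq : ∀ a b c → a * b * c ≡ b * c * a
  eq = solve-∀

-- One factor `k !` comes from choosing the subset, as C(n, k) is at most nᵏ/k!, and one from each
-- of the `m` permutations, which are decreasing on a fixed subset in a proportion 1/k! of the
-- cases.
length-chainTuples-* : ∀ n m k → length (chainTuples n m k) * (k !) ^ suc m ≤ n ^ k * (n !) ^ m
length-chainTuples-* n m k = begin
  length (chainTuples n m k) * (k !) ^ suc m                  ≤⟨ *-monoˡ-≤ ((k !) ^ suc m) (length-chainTuples n m k) ⟩
  (n C k) * X ^ m * (k ! * (k !) ^ m)                         ≡⟨ eq (n C k) (X ^ m) (k !) ((k !) ^ m) ⟩
  (n C k) * k ! * (X ^ m * (k !) ^ m)                         ≡⟨ cong ((n C k) * k ! *_) (^-distribʳ-* X (k !) m) ⟨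
  (n C k) * k ! * (X * k !) ^ m                               ≤⟨ *-mono-≤ (nCk*k!≤n^k n k) (^-monoˡ-≤ m ([n∸k]!*nCk*k!≤n! n k)) ⟩
  n ^ k * (n !) ^ m                                           ∎
  where
  X = (n ∸ k) ! * (n C k)
  eq : ∀ a b c d → a * b * (c * d) ≡ a * c * (b * d)
  eq = solve-∀

-- Chains and ranks

-- Taking successors gives the empty family the value 0, the rank of a point that starts no longer
-- chain.
maxSuc : ∀ {P : Fin n → Set} (P? : ∀ j → Dec (P j)) (f : Fin n → ℕ) →
  Σ[ t ∈ ℕ ] (∀ j → P j → f j < t) × (t ≡ 0 ⊎ ∃[ j ] (P j × t ≡ suc (f j)))
maxSuc {zero}  P? f = 0 , (λ ()) , inj₁ refl
maxSuc {suc n} P? f with P? zero | maxSuc (P? ∘ suc) (f ∘ suc)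
... | no ¬p | t , bound , att = t , (λ { zero p → contradiction p ¬p ; (suc j) p → bound j p })
            , [ inj₁ , (λ { (j , p , eq) → inj₂ (suc j , p , eq) }) ] att
... | yes p | t , bound , att with f zero <? t
...   | yes f0<t = t , (λ { zero p → f0<t ; (suc j) p → bound j p })
            , [ inj₁ , (λ { (j , p , eq) → inj₂ (suc j , p , eq) }) ] att
...   | no  f0≮t = suc (f zero) , (λ { zero p → ≤-refl ; (suc j) p → m<n⇒m<1+n (<-≤-trans (bound j p) (≮⇒≥ f0≮t)) })
            , inj₂ (zero , p , refl)

-- Consulting `R` only in index order lets the empty tuple, for which `Below` relates every pair, be
-- treated like any other: its poset is the chain of all indices. This is the case d = 2.
IsChain : (Fin n → Fin n → Set) → Subset n → Set
IsChain R S = ∀ {i j} → toℕ i < toℕ j → i ∈ˢ S → j ∈ˢ S → R i j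

-- The field `above` is what prepending needs: a point related to `i` is then related to all of
-- `set` by transitivity.
record ChainFrom (R : Fin n → Fin n → Set) (i : Fin n) (h : ℕ) : Set where
  field
    set   : Subset n
    size  : ∣ set ∣ ≡ suc h
    chain : IsChain R set
    above : ∀ {j} → j ∈ˢ set → j ≡ i ⊎ R i j

IsRank : (Fin n → Fin n → Set) → ℕ → Vec ℕ n → Set
IsRank R L r = (∀ i → lookup r i < L) × (∀ i j → toℕ i < toℕ j → R i j → lookup r j < lookup r i)

Chain : (Fin n → Fin n → Set) → ℕ → Set
Chain {n} R L = Σ[ S ∈ Subset n ] (∣ S ∣ ≡ suc L × IsChain R S)

-- Mirsky: rank i by the length of a longest chain starting at i.
chain⊎rank : ∀ (R : Fin n → Fin n → Set) → (∀ i j → Dec (R i j)) → (∀ {i j k} → R i j → R j k → R i k) → ∀ L →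
  Chain R L ⊎ Σ[ r ∈ Vec ℕ n ] (IsRank R L r × (∀ i → ChainFrom R i (lookup r i)))
chain⊎rank {zero} R R? R-trans L = inj₂ ([] , ((λ ()) , (λ ())) , (λ ()))
chain⊎rank {suc n} R R? R-trans L with chain⊎rank (λ i j → R (suc i) (suc j)) (λ i j → R? (suc i) (suc j)) R-trans L
... | inj₁ (S , ∣S∣≡1+L , S-chain) = inj₁ (outside ∷ S , ∣S∣≡1+L ,
      λ { {suc i} {suc j} (s≤s i<j) (there i∈S) (there j∈S) → S-chain i<j i∈S j∈S })
... | inj₂ (r , (r<L , r-anti) , from) with maxSuc (λ j → R? zero (suc j)) (lookup r)
... | t , bound , attained = extend (t <? L)
  where
  from-suc : ∀ {i h} → ChainFrom (λ i j → R (suc i) (suc j)) i h → ChainFrom R (suc i) h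
  from-suc c = record
    { set   = outside ∷ set
    ; size  = size
    ; chain = λ { {suc i} {suc j} (s≤s i<j) (there i∈S) (there j∈S) → chain i<j i∈S j∈S }
    ; above = λ { (there j∈S) → [ inj₁ ∘ cong suc , inj₂ ] (above j∈S) }
    }
    where open ChainFrom c
  cons : ∀ {j h} → R zero (suc j) → ChainFrom (λ i j → R (suc i) (suc j)) j h → ChainFrom R zero (suc h)
  cons {j} R0j c = record
    { set   = inside ∷ set
    ; size  = cong suc size
    ; chain = λ { {zero} {suc k} _ _ (there k∈S) → R0 k∈S
                ; {suc i} {suc k} (s≤s i<k) (there i∈S) (there k∈S) → chain i<k i∈S k∈S }
    ; above = λ { here → inj₁ refl ; (there k∈S) → inj₂ (R0 k∈S) }
    }
    where
    open ChainFrom c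
    R0 : ∀ {k} → k ∈ˢ set → R zero (suc k)
    R0 k∈S = [ (λ { refl → R0j }) , R-trans R0j ] (above k∈S)
  singleton : ChainFrom R zero 0
  singleton = record
    { set   = inside ∷ ⊥
    ; size  = cong suc (∣⊥∣≡0 n)
    ; chain = λ { {zero} {suc j} _ _ (there j∈⊥) → contradiction j∈⊥ ∉⊥
                ; {suc i} _ (there i∈⊥) _ → contradiction i∈⊥ ∉⊥ }
    ; above = λ { here → inj₁ refl ; (there j∈⊥) → contradiction j∈⊥ ∉⊥ }
    }
  from-zero : ChainFrom R zero t
  from-zero = [ (λ { refl → singleton }) , (λ { (j , R0j , refl) → cons R0j (from j) }) ] attained
  t≤L : t ≤ L
  t≤L = [ (λ { refl → z≤n }) , (λ { (j , _ , refl) → r<L j }) ] attained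
  extend : Dec (t < L) → _
  extend (yes t<L) = inj₂ (t ∷ r
    , ((λ { zero → t<L ; (suc i) → r<L i })
      , λ { zero (suc j) _ R0j → bound j R0j ; (suc i) (suc j) (s≤s i<j) Rij → r-anti i j i<j Rij })
    , λ { zero → from-zero ; (suc i) → from-suc (from i) })
  -- Here `t` equals `L`, so the chain that attains the rank of the new point has `suc L` points.
  extend (no t≮L) = inj₁ (set , trans size (cong suc (≤-antisym t≤L (≮⇒≥ t≮L))) , λ {i} {j} → chain {i} {j})
    where open ChainFrom from-zero

-- Common descents, and completing the tuples without long chains

Below : Vec (Code n) m → Fin n → Fin n → Set
Below v i j = ∀ l → toℕ (perm (lookup v l) j) < toℕ (perm (lookup v l) i)

Below? : ∀ (v : Vec (Code n) m) i j → Dec (Below v i j)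
Below? v i j = all? (λ l → toℕ (perm (lookup v l) j) <? toℕ (perm (lookup v l) i))

Below-trans : ∀ (v : Vec (Code n) m) {i j k} → Below v i j → Below v j k → Below v i k
Below-trans v ij jk l = <-trans (jk l) (ij l)

NoCommonDescent : Vec (Code n) m → Set
NoCommonDescent v = ∀ i j → toℕ i < toℕ j → ¬ Below v i j

-- A single rank class imposes no constraint, so `extensions` supplies both the distinctness of
-- these codes and, at `L = 1`, their number.
allCodes : ∀ n → List (Code n)
allCodes n = extensions (Vec.replicate n 0)

n!≤length-allCodes : ∀ n → n ! ≤ length (allCodes n)
n!≤length-allCodes n = begin
  n !                              ≤⟨ n!≤L^n*extensions 1 (Vec.replicate n 0) 0<1 ⟩
  1 ^ n * length (allCodes n)      ≡⟨ cong (_* length (allCodes n)) (^-zeroˡ n) ⟩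
  1 * length (allCodes n)          ≡⟨ *-identityˡ (length (allCodes n)) ⟩
  length (allCodes n)              ∎
  where
  0<1 : ∀ {n} (i : Fin n) → lookup (Vec.replicate n 0) i < 1
  0<1 zero    = z<s
  0<1 (suc i) = 0<1 i

-- Every element of `xs` has to account for `a`: a good one through `b * length (f x)`, a bad one by
-- its place in `ys`. Here `a` will be `n !` and `b` will be `L ^ n`.
module _ {A B : Set} {Bad : A → Set} (f : A → List B) {a b : ℕ} (split : ∀ x → Bad x ⊎ a ≤ b * length (f x)) where

  collectBad : ∀ xs → Unique xs → Σ[ ys ∈ List A ] (Unique ys × (∀ {y} → y ∈ ys → y ∈ xs) × All Bad ys ×
    a * length xs ≤ b * length (concatMap f xs) + a * length ys)
  collectBad [] [] = [] , [] , (λ ()) , [] , m≤n+m (a * 0) (b * 0)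
  collectBad (x ∷ xs) (x∉xs ∷ xs!) with split x | collectBad xs xs!
  ... | inj₁ bad | ys , ys! , ys⊆xs , bads , bound =
        x ∷ ys , All.tabulate (λ y∈ys → All.lookup x∉xs (ys⊆xs y∈ys)) ∷ ys!
      , (λ { (here refl) → here refl ; (there y∈ys) → there (ys⊆xs y∈ys) })
      , bad ∷ bads
      , (begin
          a * suc (length xs)                                         ≡⟨ *-suc a (length xs) ⟩
          a + a * length xs                                           ≤⟨ +-monoʳ-≤ a bound ⟩
          a + (b * length (concatMap f xs) + a * length ys)           ≤⟨ m≤n+m _ (b * length (f x)) ⟩
          b * length (f x) + (a + (b * length (concatMap f xs) + a * length ys))
            ≡⟨ eq a b (length (f x)) (length (concatMap f xs)) (length ys) ⟩
          b * (length (f x) + length (concatMap f xs)) + a * suc (length ys)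
            ≡⟨ cong (λ z → b * z + a * suc (length ys)) (length-++ (f x)) ⟨
          b * length (f x ++ concatMap f xs) + a * suc (length ys) ∎)
    where
    eq : ∀ a b p q r → b * p + (a + (b * q + a * r)) ≡ b * (p + q) + a * (1 + r)
    eq = solve-∀
  ... | inj₂ good | ys , ys! , ys⊆xs , bads , bound =
        ys , ys! , there ∘ ys⊆xs , bads
      , (begin
          a * suc (length xs)                                         ≡⟨ *-suc a (length xs) ⟩
          a + a * length xs                                           ≤⟨ +-mono-≤ good bound ⟩
          b * length (f x) + (b * length (concatMap f xs) + a * length ys)
            ≡⟨ eq b (length (f x)) (length (concatMap f xs)) (a * length ys) ⟩
          b * (length (f x) + length (concatMap f xs)) + a * length ys
            ≡⟨ cong (λ z → b * z + a * length ys) (length-++ (f x)) ⟨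
          b * length (f x ++ concatMap f xs) + a * length ys ∎)
    where
    eq : ∀ b p q r → b * p + (b * q + r) ≡ b * (p + q) + r
    eq = solve-∀

ranked : ℕ → Vec (Code n) m → Set
ranked L v = Σ[ r ∈ Vec ℕ _ ] IsRank (Below v) L r

chain⊎ranked : ∀ L (v : Vec (Code n) m) → Chain (Below v) L ⊎ ranked L v
chain⊎ranked L v with chain⊎rank (Below v) (Below? v) (λ {i} {j} {k} → Below-trans v {i} {j} {k}) L
... | inj₁ c                = inj₁ c
... | inj₂ (r , r-rank , _) = inj₂ (r , r-rank)

-- The new permutation goes to the head, so `tail` recovers `v` and different tuples have disjoint
-- completions.
completions : ∀ {L} (v : Vec (Code n) m) → Chain (Below v) L ⊎ ranked L v → List (Vec (Code n) (suc m))
completions v (inj₁ _)       = []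
completions v (inj₂ (r , _)) = map (_∷ v) (extensions r)

∈-completions⁻ : ∀ {L} (v : Vec (Code n) m) (c : Chain (Below v) L ⊎ ranked L v) {w} → w ∈ completions v c → Vec.tail w ≡ v × NoCommonDescent w
∈-completions⁻ v (inj₂ (r , _ , r-anti)) w∈ with ∈-map⁻ (_∷ v) w∈
... | cs , cs∈ , refl = refl , λ i j i<j below →
  <-asym (below zero) (extensions-antitone r cs∈ i j (r-anti i j i<j (below ∘ suc)))

completions-unique : ∀ {L} (v : Vec (Code n) m) (c : Chain (Below v) L ⊎ ranked L v) → Unique (completions v c)
completions-unique v (inj₁ _)       = []
completions-unique v (inj₂ (r , _)) = Unique.map⁺ (λ { refl → refl }) (extensions-unique r)

avoiders : ∀ n m L → List (Vec (Code n) (suc m))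
avoiders n m L = concatMap (λ v → completions v (chain⊎ranked L v)) (tuples (allCodes n) m)

avoiders-unique : ∀ n m L → Unique (avoiders n m L)
avoiders-unique n m L = Unique.concat⁺
  (All.map⁺ (All.tabulate (λ {v} _ → completions-unique v (chain⊎ranked L v))))
  (AllPairs.map⁺ (AllPairs.map (λ { {v} {w} v≢w (x∈ , x∈′) → v≢w
      (trans (sym (proj₁ (∈-completions⁻ v (chain⊎ranked L v) x∈))) (proj₁ (∈-completions⁻ w (chain⊎ranked L w) x∈′))) })
    (tuples-unique m (extensions-unique (Vec.replicate n 0)))))

avoiders-noCommonDescent : ∀ n m L {w} → w ∈ avoiders n m L → NoCommonDescent w
avoiders-noCommonDescent n m L w∈ with Any.satisfied (∈-concatMap⁻ (λ v → completions v (chain⊎ranked L v)) {xs = tuples (allCodes n) m} w∈)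
... | v , w∈′ = proj₂ (∈-completions⁻ v (chain⊎ranked L v) w∈′)

-- The count is doubled: tuples with a long chain make up at most half of `(n !) ^ m`, so they
-- account for at most one of two copies of `(n !) ^ suc m`, and that copy cancels.
length-avoiders : ∀ n m L → 2 * length (chainTuples n m (suc L)) ≤ (n !) ^ m → (n !) ^ suc m ≤ 2 * L ^ n * length (avoiders n m L)
length-avoiders n m L few-chains with collectBad (λ v → completions v (chain⊎ranked L v)) {n !} {L ^ n} split (tuples (allCodes n) m) (tuples-unique m (extensions-unique (Vec.replicate n 0)))
  where
  split : ∀ v → Chain (Below v) L ⊎ n ! ≤ L ^ n * length (completions v (chain⊎ranked L v))
  split v with chain⊎ranked L v
  ... | inj₁ c = inj₁ c
  ... | inj₂ (r , r<L , _) = inj₂ (≤-trans (n!≤L^n*extensions L r r<L) (≤-reflexive (cong (L ^ n *_) (sym (length-map (_∷ v) (extensions r))))))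
... | ys , ys! , _ , bads , bound = +-cancelʳ-≤ (n ! * (n !) ^ m) _ _ (begin
  n ! * (n !) ^ m + n ! * (n !) ^ m                    ≡⟨ eq₁ (n !) ((n !) ^ m) ⟩
  2 * (n ! * (n !) ^ m)                                ≤⟨ *-monoʳ-≤ 2 (*-monoʳ-≤ (n !) (^-monoˡ-≤ m (n!≤length-allCodes n))) ⟩
  2 * (n ! * length (allCodes n) ^ m)                  ≡⟨ cong (λ z → 2 * (n ! * z)) (length-tuples (allCodes n) m) ⟨
  2 * (n ! * length (tuples (allCodes n) m))           ≤⟨ *-monoʳ-≤ 2 bound ⟩
  2 * (L ^ n * length (avoiders n m L) + n ! * length ys) ≡⟨ eq₂ (L ^ n) (length (avoiders n m L)) (n !) (length ys) ⟩
  2 * L ^ n * length (avoiders n m L) + n ! * (2 * length ys) ≤⟨ +-monoʳ-≤ (2 * L ^ n * length (avoiders n m L)) (*-monoʳ-≤ (n !) (≤-trans (*-monoʳ-≤ 2 ys≤) few-chains)) ⟩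
  2 * L ^ n * length (avoiders n m L) + n ! * (n !) ^ m ∎)
  where
  ys≤ : length ys ≤ length (chainTuples n m (suc L))
  ys≤ = Unique∧⊆⇒length≤ ys! (λ {v} v∈ → case-chain v (All.lookup bads v∈))
    where
    case-chain : ∀ v → Chain (Below v) L → v ∈ chainTuples n m (suc L)
    case-chain v (S , size , chain) = subst (λ z → v ∈ chainTuples n m z) size
      (∈-chainTuples S v (λ l i<j i∈S j∈S → chain i<j i∈S j∈S l))
  eq₁ : ∀ x y → x * y + x * y ≡ 2 * (x * y)
  eq₁ = solve-∀
  eq₂ : ∀ p q x y → 2 * (p * q + x * y) ≡ 2 * p * q + x * (2 * y)
  eq₂ = solve-∀

few-chainTuples : ∀ n m k → 2 * n ^ k ≤ (k !) ^ suc m → 2 * length (chainTuples n m k) ≤ (n !) ^ m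
few-chainTuples n m k 2n^k≤k!^ = *-cancelʳ-≤ _ _ ((k !) ^ suc m) {{m^n≢0 (k !) (suc m) {{k !≢0}}}} (begin
  2 * length (chainTuples n m k) * (k !) ^ suc m     ≡⟨ *-assoc 2 (length (chainTuples n m k)) ((k !) ^ suc m) ⟩
  2 * (length (chainTuples n m k) * (k !) ^ suc m)   ≤⟨ *-monoʳ-≤ 2 (length-chainTuples-* n m k) ⟩
  2 * (n ^ k * (n !) ^ m)                            ≡⟨ *-assoc 2 (n ^ k) ((n !) ^ m) ⟨
  2 * n ^ k * (n !) ^ m                              ≤⟨ *-monoˡ-≤ ((n !) ^ m) 2n^k≤k!^ ⟩
  (k !) ^ suc m * (n !) ^ m                          ≡⟨ *-comm ((k !) ^ suc m) ((n !) ^ m) ⟩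
  (n !) ^ m * (k !) ^ suc m                          ∎)

no-chainTuples : ∀ n m → 2 * length (chainTuples n m (suc n)) ≤ (n !) ^ m
no-chainTuples n m = ≤-trans (*-monoʳ-≤ 2 (≤-trans (length-chainTuples n m (suc n))
  (≤-reflexive (cong (_* ((n ∸ suc n) ! * (n C suc n)) ^ m) (k>n⇒nCk≡0 {n} {suc n} ≤-refl))))) z≤n

-- n^k/(k!)^(m+1) bounds the expected number of k-chains; the search stops at the first
-- k = L + 1 where it is at most 1/2, or at k = n + 1, where there are no chains.
threshold : ∀ n m → 1 ≤ n → Σ[ L ∈ ℕ ] (1 ≤ L × L ≤ n × (L !) ^ suc m ≤ 2 * n ^ L × 2 * length (chainTuples n m (suc L)) ≤ (n !) ^ m)
threshold n m 1≤n = search (n ∸ 1) 1 (m+[n∸m]≡n 1≤n) ≤-refl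
  (≤-trans (≤-reflexive (^-zeroˡ (suc m))) (≤-trans (s≤s z≤n) (*-monoʳ-≤ 2 (≤-trans 1≤n (≤-reflexive (sym (*-identityʳ n)))))))
  where
  search : ∀ g L → L + g ≡ n → 1 ≤ L → (L !) ^ suc m ≤ 2 * n ^ L →
    Σ[ L ∈ ℕ ] (1 ≤ L × L ≤ n × (L !) ^ suc m ≤ 2 * n ^ L × 2 * length (chainTuples n m (suc L)) ≤ (n !) ^ m)
  search zero L L+0≡n 1≤L inv with trans (sym (+-identityʳ L)) L+0≡n
  ... | refl = L , 1≤L , ≤-refl , inv , no-chainTuples L m
  search (suc g) L L+1+g≡n 1≤L inv with 2 * n ^ suc L ≤? (suc L !) ^ suc m
  ... | yes below = L , 1≤L , ≤-trans (m≤m+n L (suc g)) (≤-reflexive L+1+g≡n) , inv , few-chainTuples n m (suc L) below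
  -- The failed test is itself the invariant at `suc L`.
  ... | no ¬below = search g (suc L) (trans (sym (+-suc L g)) L+1+g≡n) (s≤s z≤n) (≰⇒≥ ¬below)

-- From permutation tuples to matrices

-- Point j has coordinates (n-1-j, σ₀ j, …, σₘ₋₁ j): with the first coordinate reversed,
-- strictly comparable points are exactly the common descents.
point : Vec (Code n) m → Fin n → Pos (suc m) (λ _ → n)
point v j zero    = opposite j
point v j (suc l) = perm (lookup v l) j

matches? : ∀ (v : Vec (Code n) m) (x : Pos (suc m) (λ _ → n)) → Dec (∃[ j ] (x ≈P point v j))
matches? v x = any? (λ j → all? (λ i → x i ≟ᶠ point v j i))

matrix : Vec (Code n) m → Cube (suc m) n
matrix v x = ⌊ matches? v x ⌋

⌊⌋≡true⁺ : ∀ {P : Set} (P? : Dec P) → P → ⌊ P? ⌋ ≡ true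
⌊⌋≡true⁺ P? p = Equivalence.to T-≡ (fromWitness {a? = P?} p)

⌊⌋≡true⁻ : ∀ {P : Set} (P? : Dec P) → ⌊ P? ⌋ ≡ true → P
⌊⌋≡true⁻ P? eq = toWitness {a? = P?} (Equivalence.from T-≡ eq)

opposite-injective : ∀ {i j : Fin n} → opposite i ≡ opposite j → i ≡ j
opposite-injective {i = i} {j} eq = trans (sym (opposite-involutive i)) (trans (cong opposite eq) (opposite-involutive j))

opposite-cancel-< : ∀ {i j : Fin n} → toℕ (opposite i) < toℕ (opposite j) → toℕ j < toℕ i
opposite-cancel-< {n} {i} {j} i′<j′ = ≰⇒> (λ i≤j → <⇒≱
  (subst₂ _<_ (opposite-prop i) (opposite-prop j) i′<j′) (∸-monoʳ-≤ n (s≤s i≤j)))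

point-injective : ∀ (v : Vec (Code n) m) i {j j′} → point v j i ≡ point v j′ i → j ≡ j′
point-injective v zero    eq = opposite-injective eq
point-injective v (suc l) eq = perm-injective (lookup v l) eq

matrix-point : ∀ (v : Vec (Code n) m) j → matrix v (point v j) ≡ true
matrix-point v j = ⌊⌋≡true⁺ (matches? v (point v j)) (j , λ _ → refl)

matrix-isPerm : ∀ (v : Vec (Code n) m) → IsPermMatrix (suc m) n (matrix v)
matrix-isPerm v = (point v , (λ j j′ eq → opposite-injective (eq zero)) , (λ x → ⌊⌋≡true⁻ (matches? v x)) , matrix-point v)
                , distinct
  where
  distinct : ∀ x y → matrix v x ≡ true → matrix v y ≡ true → ¬ (x ≈P y) → ∀ i → x i ≢ y i
  distinct x y x∈ y∈ x≉y i xi≡yi with ⌊⌋≡true⁻ (matches? v x) x∈ | ⌊⌋≡true⁻ (matches? v y) y∈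
  ... | j , x≈ | j′ , y≈ with point-injective v i (trans (sym (x≈ i)) (trans xi≡yi (y≈ i)))
  ...   | refl = x≉y (λ i → trans (x≈ i) (sym (y≈ i)))

matrix-avoids : ∀ (v : Vec (Code n) m) → NoCommonDescent v → Avoids (matrix v) (Id (suc m) 2)
matrix-avoids {m = m} v ncd (f , f-inc , f-emb)
  with ⌊⌋≡true⁻ (matches? v (λ i → f i zero)) (f-emb (λ _ → zero) (⌊⌋≡true⁺ (all? {n = suc m} (λ i → zero {1} ≟ᶠ zero)) (λ _ → refl)))
     | ⌊⌋≡true⁻ (matches? v (λ i → f i (suc zero))) (f-emb (λ _ → suc zero) (⌊⌋≡true⁺ (all? {n = suc m} (λ i → suc {1} zero ≟ᶠ suc zero)) (λ _ → refl)))
-- The two entries increase in every coordinate. The reversed coordinate puts `j′` before `j`, while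
-- every permutation is larger at `j′`: a common descent.
... | j , x≈ | j′ , y≈ = ncd j′ j (opposite-cancel-< (increasing zero)) (increasing ∘ suc)
  where
  increasing : ∀ i → toℕ (point v j i) < toℕ (point v j′ i)
  increasing i = subst₂ (λ p q → toℕ p < toℕ q) (x≈ i) (y≈ i) (f-inc i zero (suc zero) z<s)

-- Coordinate zero is the reversed index, so a 1-entry shared by both matrices comes from the same
-- index in both tuples.
matrix-faithful : ∀ (v w : Vec (Code n) m) → matrix v ≈M matrix w → v ≡ w
matrix-faithful v w eq = trans (sym (tabulate∘lookup v)) (trans (tabulate-cong same) (tabulate∘lookup w))
  where
  same : ∀ l → lookup v l ≡ lookup w l
  same l = perm-faithful (lookup v l) (lookup w l) agree
    where
    agree : ∀ j → perm (lookup v l) j ≡ perm (lookup w l) j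
    agree j with ⌊⌋≡true⁻ (matches? w (point v j)) (trans (sym (eq (point v j))) (matrix-point v j))
    ... | j′ , v≈w with opposite-injective (v≈w zero)
    ...   | refl = v≈w (suc l)

toElems : (vs : List (Vec (Code n) m)) → All NoCommonDescent vs → List (SElem (Id (suc m) 2) n)
toElems []       []           = []
toElems (v ∷ vs) (ncd ∷ ncds) = record { mat = matrix v ; isPerm = matrix-isPerm v ; avoids = matrix-avoids v ncd } ∷ toElems vs ncds

length-toElems : ∀ (vs : List (Vec (Code n) m)) ncds → length (toElems vs ncds) ≡ length vs
length-toElems []       []           = refl
length-toElems (v ∷ vs) (ncd ∷ ncds) = cong suc (length-toElems vs ncds)

toElems-distinct : ∀ (vs : List (Vec (Code n) m)) ncds → Unique vs → DistinctList (toElems vs ncds)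
toElems-distinct []       []           []           = []
toElems-distinct {n} {m} (v ∷ vs) (ncd ∷ ncds) (v∉vs ∷ vs!) = apart vs ncds v∉vs ∷ toElems-distinct vs ncds vs!
  where
  apart : ∀ ws ncds → All (v ≢_) ws → All (λ e → ¬ (matrix v ≈M SElem.mat e)) (toElems ws ncds)
  apart []       []           []           = []
  apart (w ∷ ws) (ncd ∷ ncds) (v≢w ∷ v∉ws) = (v≢w ∘ matrix-faithful v w) ∷ apart ws ncds v∉ws

-- Assembling the estimate

^-cancelʳ-≤ : ∀ a b m .{{_ : NonZero m}} → a ^ m ≤ b ^ m → a ≤ b
^-cancelʳ-≤ a b m a^m≤b^m = ≮⇒≥ (λ b<a → <⇒≱ (^-monoˡ-< m b<a) a^m≤b^m)

n^n*n^nn≤n!*[1+n]^nn : ∀ n .{{_ : NonZero n}} → n ^ n * (n ^ n) ^ n ≤ n ! * (suc n ^ n) ^ n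
n^n*n^nn≤n!*[1+n]^nn n@(suc n′) = ≤-trans (*-monoˡ-≤ ((n ^ n) ^ n) (m≤n*m (n ^ n) 2)) (2k^k≤k!e^k n′ ≤-refl)

^-comm : ∀ a x y → (a ^ x) ^ y ≡ (a ^ y) ^ x
^-comm a x y = trans (^-*-assoc a x y) (trans (cong (a ^_) (*-comm x y)) (sym (^-*-assoc a y x)))

-- L ≤ e n^(1/D), with e replaced by (1 + 1/n)ⁿ and both sides raised to the power D.
threshold-bound : ∀ {n L} D .{{_ : NonZero D}} → 1 ≤ L → L ≤ n → (L !) ^ D ≤ 2 * n ^ L → (L * n ^ n) ^ D ≤ n * (suc n ^ n) ^ D
threshold-bound {n} {suc L′} D@(suc D′) 1≤L L≤n L!^D≤2n^L = ^-cancelʳ-≤ _ _ L (*-cancelˡ-≤ 2 (begin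
  -- The factor 2 of `2k^k≤k!e^k` yields 2^D, at least the 2 of the threshold condition. Both sides
  -- then carry the same 2, and after cancelling it the `L`-th root is exact.
  2 * ((L * nⁿ) ^ D) ^ L           ≤⟨ *-monoˡ-≤ (((L * nⁿ) ^ D) ^ L) (*-monoʳ-≤ 2 (m^n>0 2 D′)) ⟩
  2 ^ D * ((L * nⁿ) ^ D) ^ L       ≡⟨ cong (2 ^ D *_) (^-comm (L * nⁿ) D L) ⟩
  2 ^ D * ((L * nⁿ) ^ L) ^ D       ≡⟨ ^-distribʳ-* 2 ((L * nⁿ) ^ L) D ⟨
  (2 * (L * nⁿ) ^ L) ^ D           ≡⟨ cong (λ z → (2 * z) ^ D) (^-distribʳ-* L nⁿ L) ⟩
  (2 * (L ^ L * nⁿ ^ L)) ^ D       ≡⟨ cong (_^ D) (*-assoc 2 (L ^ L) (nⁿ ^ L)) ⟨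
  (2 * L ^ L * nⁿ ^ L) ^ D         ≤⟨ ^-monoˡ-≤ D (2k^k≤k!e^k L′ L≤n) ⟩
  (L ! * [1+n]ⁿ ^ L) ^ D               ≡⟨ ^-distribʳ-* (L !) ([1+n]ⁿ ^ L) D ⟩
  (L !) ^ D * ([1+n]ⁿ ^ L) ^ D         ≤⟨ *-monoˡ-≤ (([1+n]ⁿ ^ L) ^ D) L!^D≤2n^L ⟩
  2 * n ^ L * ([1+n]ⁿ ^ L) ^ D         ≡⟨ cong (2 * n ^ L *_) (^-comm [1+n]ⁿ L D) ⟩
  2 * n ^ L * ([1+n]ⁿ ^ D) ^ L         ≡⟨ *-assoc 2 (n ^ L) (([1+n]ⁿ ^ D) ^ L) ⟩
  2 * (n ^ L * ([1+n]ⁿ ^ D) ^ L)       ≡⟨ cong (2 *_) (^-distribʳ-* n ([1+n]ⁿ ^ D) L) ⟨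
  2 * (n * [1+n]ⁿ ^ D) ^ L             ∎))
  where
  L = suc L′
  nⁿ = n ^ n
  [1+n]ⁿ = suc n ^ n

-- With e short for (1 + 1/n)ⁿ: in the `D`-th power of the count, 2^D costs e^D and L^(Dn) costs nⁿ
-- e^(Dn). The remaining nⁿ is at most n! eⁿ, which removes one n! from (n!)^(D²) and leaves D² - 1
-- = `(2 + m) * m` of them. The exponents of e add up to `suc m + (2 + m) * n`.
final-bound : ∀ {n L s} m → 1 ≤ n → (L * n ^ n) ^ suc m ≤ n * (suc n ^ n) ^ suc m → (n !) ^ suc m ≤ 2 * L ^ n * s →
  (n !) ^ ((2 + m) * m) * n ^ (n * (suc m + (2 + m) * n)) ≤ (s * n) ^ suc m * suc n ^ (n * (suc m + (2 + m) * n))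
final-bound {n} {L} {s} m 1≤n LA≤nB n!^D≤ = *-cancelˡ-≤ (n !) {{n !≢0}} (begin
  n ! * (F * n ^ (n * M))                          ≡⟨ cong (λ x → n ! * (F * x)) (split-power n) ⟩
  n ! * (F * (nⁿ ^ D * ((nⁿ ^ D) ^ n * nⁿ ^ n)))      ≡⟨ eq₁ (n !) F (nⁿ ^ D) ((nⁿ ^ D) ^ n) (nⁿ ^ n) ⟩
  n ! * F * nⁿ ^ D * (nⁿ ^ D) ^ n * nⁿ ^ n            ≡⟨ cong (λ x → x * nⁿ ^ D * (nⁿ ^ D) ^ n * nⁿ ^ n) n!^DD ⟩
  ((n !) ^ D) ^ D * nⁿ ^ D * (nⁿ ^ D) ^ n * nⁿ ^ n    ≤⟨ *-monoˡ-≤ (nⁿ ^ n) (*-monoˡ-≤ ((nⁿ ^ D) ^ n) (*-monoˡ-≤ (nⁿ ^ D) (^-monoˡ-≤ D n!^D≤))) ⟩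
  (2 * L ^ n * s) ^ D * nⁿ ^ D * (nⁿ ^ D) ^ n * nⁿ ^ n
    ≡⟨ cong (λ x → x * nⁿ ^ D * (nⁿ ^ D) ^ n * nⁿ ^ n) (trans (^-distribʳ-* (2 * L ^ n) s D) (cong (_* s ^ D) (trans (^-distribʳ-* 2 (L ^ n) D) (cong (2 ^ D *_) (^-comm L n D))))) ⟩
  2 ^ D * (L ^ D) ^ n * s ^ D * nⁿ ^ D * (nⁿ ^ D) ^ n * nⁿ ^ n
    ≡⟨ eq₂ (2 ^ D) ((L ^ D) ^ n) (s ^ D) (nⁿ ^ D) ((nⁿ ^ D) ^ n) (nⁿ ^ n) ⟩
  (2 ^ D * nⁿ ^ D) * s ^ D * ((L ^ D) ^ n * (nⁿ ^ D) ^ n) * nⁿ ^ n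
    ≡⟨ cong₂ (λ x y → x * s ^ D * y * nⁿ ^ n) (sym (^-distribʳ-* 2 nⁿ D))
         (trans (sym (^-distribʳ-* (L ^ D) (nⁿ ^ D) n)) (cong (_^ n) (sym (^-distribʳ-* L nⁿ D)))) ⟩
  (2 * nⁿ) ^ D * s ^ D * ((L * nⁿ) ^ D) ^ n * nⁿ ^ n
    ≤⟨ *-monoˡ-≤ (nⁿ ^ n) (*-mono-≤ (*-monoˡ-≤ (s ^ D) (^-monoˡ-≤ D (2n^n≤[1+n]^n n))) (^-monoˡ-≤ n LA≤nB)) ⟩
  [1+n]ⁿ ^ D * s ^ D * (n * [1+n]ⁿ ^ D) ^ n * nⁿ ^ n
    ≡⟨ cong (λ x → [1+n]ⁿ ^ D * s ^ D * x * nⁿ ^ n) (^-distribʳ-* n ([1+n]ⁿ ^ D) n) ⟩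
  [1+n]ⁿ ^ D * s ^ D * (nⁿ * ([1+n]ⁿ ^ D) ^ n) * nⁿ ^ n
    ≡⟨ eq₃ ([1+n]ⁿ ^ D) (s ^ D) nⁿ (([1+n]ⁿ ^ D) ^ n) (nⁿ ^ n) ⟩
  [1+n]ⁿ ^ D * s ^ D * ([1+n]ⁿ ^ D) ^ n * (nⁿ * nⁿ ^ n)
    ≤⟨ *-monoʳ-≤ ([1+n]ⁿ ^ D * s ^ D * ([1+n]ⁿ ^ D) ^ n) (n^n*n^nn≤n!*[1+n]^nn n) ⟩
  [1+n]ⁿ ^ D * s ^ D * ([1+n]ⁿ ^ D) ^ n * (n ! * [1+n]ⁿ ^ n)
    ≡⟨ eq₄ ([1+n]ⁿ ^ D) (s ^ D) (([1+n]ⁿ ^ D) ^ n) (n !) ([1+n]ⁿ ^ n) ⟩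
  n ! * (s ^ D * ([1+n]ⁿ ^ D * (([1+n]ⁿ ^ D) ^ n * [1+n]ⁿ ^ n)))
    ≡⟨ cong (λ x → n ! * (s ^ D * x)) (split-power (suc n)) ⟨
  n ! * (s ^ D * suc n ^ (n * M))
    -- The factor 1/n of the claim enters here, as `s ≤ s * n`.
    ≤⟨ *-monoʳ-≤ (n !) (*-monoˡ-≤ (suc n ^ (n * M)) (^-monoˡ-≤ D (m≤m*n s n))) ⟩
  n ! * ((s * n) ^ D * suc n ^ (n * M)) ∎)
  where
  instance
    n≢0 : NonZero n
    n≢0 = >-nonZero 1≤n
  D = suc m
  M = suc m + (2 + m) * n
  nⁿ = n ^ n
  [1+n]ⁿ = suc n ^ n
  F = (n !) ^ ((2 + m) * m)
  split-power : ∀ c → c ^ (n * M) ≡ (c ^ n) ^ D * (((c ^ n) ^ D) ^ n * (c ^ n) ^ n)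
  split-power c = begin-equality
    c ^ (n * M)                                             ≡⟨ ^-*-assoc c n M ⟨
    (c ^ n) ^ (D + (n + D * n))                             ≡⟨ ^-distribˡ-+-* (c ^ n) D (n + D * n) ⟩
    (c ^ n) ^ D * (c ^ n) ^ (n + D * n)                     ≡⟨ cong (λ x → (c ^ n) ^ D * (c ^ n) ^ x) (+-comm n (D * n)) ⟩
    (c ^ n) ^ D * (c ^ n) ^ (D * n + n)                     ≡⟨ cong ((c ^ n) ^ D *_) (^-distribˡ-+-* (c ^ n) (D * n) n) ⟩
    (c ^ n) ^ D * ((c ^ n) ^ (D * n) * (c ^ n) ^ n)         ≡⟨ cong (λ x → (c ^ n) ^ D * (x * (c ^ n) ^ n)) (^-*-assoc (c ^ n) D n) ⟨
    (c ^ n) ^ D * (((c ^ n) ^ D) ^ n * (c ^ n) ^ n)         ∎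
  n!^DD : n ! * F ≡ ((n !) ^ D) ^ D
  n!^DD = trans (cong (n ! ^_) (exponent m)) (sym (^-*-assoc (n !) D D))
    where
    exponent : ∀ m → 1 + (2 + m) * m ≡ (1 + m) * (1 + m)
    exponent = solve-∀
  eq₁ : ∀ a b c d e → a * (b * (c * (d * e))) ≡ a * b * c * d * e
  eq₁ = solve-∀
  eq₂ : ∀ a b c d e f → a * b * c * d * e * f ≡ (a * d) * c * (b * e) * f
  eq₂ = solve-∀
  eq₃ : ∀ a b c d e → a * b * (c * d) * e ≡ a * b * d * (c * e)
  eq₃ = solve-∀
  eq₄ : ∀ a b c d e → a * b * c * (d * e) ≡ d * (b * (a * (c * e)))
  eq₄ = solve-∀

-- Transfer to the rationals and to the exponential series

toℚᵘ-/ : ∀ i d .{{_ : NonZero d}} → ℚ.toℚᵘ (i ℚ./ d) ℚᵘ.≃ i ℚᵘ./ d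
toℚᵘ-/ i (suc d) = ℚ.toℚᵘ-fromℚᵘ (ℚᵘ.mkℚᵘ i d)

ℕ→ℚ-homo-* : ∀ a b → ℕ→ℚ (a * b) ≡ ℕ→ℚ a ℚ.* ℕ→ℚ b
ℕ→ℚ-homo-* a b = ℚ.toℚᵘ-injective (ℚᵘ.≃-trans (toℚᵘ-/ (ℤ.+ (a * b)) 1) (ℚᵘ.≃-trans
  (ℚᵘ.*≡* (cong (ℤ._* ℤ.1ℤ) (ℤ.pos-* a b)))
  (ℚᵘ.≃-sym (ℚᵘ.≃-trans (ℚ.toℚᵘ-homo-* (ℕ→ℚ a) (ℕ→ℚ b)) (ℚᵘ.*-cong (toℚᵘ-/ (ℤ.+ a) 1) (toℚᵘ-/ (ℤ.+ b) 1))))))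

ℕ→ℚ-homo-+ : ∀ a b → ℕ→ℚ (a + b) ≡ ℕ→ℚ a ℚ.+ ℕ→ℚ b
ℕ→ℚ-homo-+ a b = ℚ.toℚᵘ-injective (ℚᵘ.≃-trans (toℚᵘ-/ (ℤ.+ (a + b)) 1) (ℚᵘ.≃-trans
  (ℚᵘ.*≡* (cong (ℤ._* ℤ.1ℤ) (trans (ℤ.pos-+ a b) (sym (cong₂ ℤ._+_ (ℤ.*-identityʳ (ℤ.+ a)) (ℤ.*-identityʳ (ℤ.+ b)))))))
  (ℚᵘ.≃-sym (ℚᵘ.≃-trans (ℚ.toℚᵘ-homo-+ (ℕ→ℚ a) (ℕ→ℚ b)) (ℚᵘ.+-cong (toℚᵘ-/ (ℤ.+ a) 1) (toℚᵘ-/ (ℤ.+ b) 1))))))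

ℕ→ℚ-mono-≤ : ∀ {a b} → a ≤ b → ℕ→ℚ a ℚ.≤ ℕ→ℚ b
ℕ→ℚ-mono-≤ {a} {b} a≤b = ℚ.toℚᵘ-cancel-≤ (ℚᵘ.≤-respˡ-≃ (ℚᵘ.≃-sym (toℚᵘ-/ (ℤ.+ a) 1)) (ℚᵘ.≤-respʳ-≃ (ℚᵘ.≃-sym (toℚᵘ-/ (ℤ.+ b) 1))
  (ℚᵘ.*≤* (ℤ.*-monoʳ-≤-nonNeg ℤ.1ℤ (ℤ.+≤+ a≤b)))))

ℕ→ℚ-*-/ : ∀ a d .{{_ : NonZero d}} → ℕ→ℚ d ℚ.* (ℤ.+ a ℚ./ d) ≡ ℕ→ℚ a
ℕ→ℚ-*-/ a d@(suc _) = ℚ.toℚᵘ-injective (ℚᵘ.≃-trans (ℚ.toℚᵘ-homo-* (ℕ→ℚ d) (ℤ.+ a ℚ./ d)) (ℚᵘ.≃-trans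
  (ℚᵘ.*-cong (toℚᵘ-/ (ℤ.+ d) 1) (toℚᵘ-/ (ℤ.+ a) d)) (ℚᵘ.≃-trans
  (ℚᵘ.*≡* (trans (ℤ.*-identityʳ (ℤ.+ d ℤ.* ℤ.+ a)) (trans (ℤ.*-comm (ℤ.+ d) (ℤ.+ a)) (cong (λ x → ℤ.+ a ℤ.* ℤ.+ x) (sym (+-identityʳ d))))))
  (ℚᵘ.≃-sym (toℚᵘ-/ (ℤ.+ a) 1)))))

scaledExp≡N!*expPartial : ∀ m N → ℕ→ℚ (scaledExp 1 m N) ≡ ℕ→ℚ (N !) ℚ.* expPartial m N
scaledExp≡N!*expPartial m zero    = refl
scaledExp≡N!*expPartial m (suc N) =
  trans (cong (λ x → ℕ→ℚ (x * (e + m ^ N))) (*-identityʳ (suc N)))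
  (trans (ℕ→ℚ-homo-* (suc N) (e + m ^ N))
  (trans (cong (ℕ→ℚ (suc N) ℚ.*_) sum-eq)
  (trans (sym (ℚ.*-assoc (ℕ→ℚ (suc N)) (ℕ→ℚ (N !)) (expPartial m (suc N))))
         (cong (ℚ._* expPartial m (suc N)) (sym (ℕ→ℚ-homo-* (suc N) (N !)))))))
  where
  e = scaledExp 1 m N
  t = ((ℤ.+ (m ^ N)) ℚ./ (N !)) {{N !≢0}}
  sum-eq : ℕ→ℚ (e + m ^ N) ≡ ℕ→ℚ (N !) ℚ.* expPartial m (suc N)
  sum-eq =
    trans (ℕ→ℚ-homo-+ e (m ^ N))
    (trans (cong₂ ℚ._+_ (scaledExp≡N!*expPartial m N) (sym (ℕ→ℚ-*-/ (m ^ N) (N !) {{N !≢0}})))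
           (sym (ℚ.*-distribˡ-+ (ℕ→ℚ (N !)) (expPartial m N) t)))

≤*expPartial : ∀ {x y} m N → x * N ! ≤ y * scaledExp 1 m N → ℕ→ℚ x ℚ.≤ ℕ→ℚ y ℚ.* expPartial m N
≤*expPartial {x} {y} m N x*N!≤y*e = ℚ.*-cancelʳ-≤-pos (ℕ→ℚ (N !)) {{N!-positive}} (subst₂ ℚ._≤_ (ℕ→ℚ-homo-* x (N !)) eq (ℕ→ℚ-mono-≤ x*N!≤y*e))
  where
  N!-positive : ℚ.Positive (ℕ→ℚ (N !))
  N!-positive = ℚ.normalize-pos (N !) 1 {{_}} {{N !≢0}}
  eq : ℕ→ℚ (y * scaledExp 1 m N) ≡ ℕ→ℚ y ℚ.* expPartial m N ℚ.* ℕ→ℚ (N !)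
  eq = trans (ℕ→ℚ-homo-* y (scaledExp 1 m N)) (trans (cong (ℕ→ℚ y ℚ.*_) (trans (scaledExp≡N!*expPartial m N) (ℚ.*-comm (ℕ→ℚ (N !)) (expPartial m N))))
    (sym (ℚ.*-assoc (ℕ→ℚ y) (expPartial m N) (ℕ→ℚ (N !)))))

exponential-bound : ∀ n .{{_ : NonZero n}} M x y → x * n ^ (n * M) ≤ y * suc n ^ (n * M) → ∃[ N ] (ℕ→ℚ x ℚ.≤ ℕ→ℚ y ℚ.* expPartial M N)
-- The expansion of (1 + 1/n)^q has q + 1 terms, and the first q + 1 terms of the series of e^M
-- dominate them.
exponential-bound n M x y bound = suc q , ≤*expPartial {x} {y} M (suc q) (*-cancelʳ-≤ (x * (suc q) !) (y * e) (n ^ q) {{m^n≢0 n q}} (begin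
    x * (suc q) ! * n ^ q                        ≡⟨ swap x ((suc q) !) (n ^ q) ⟩
    x * n ^ q * (suc q) !                        ≤⟨ *-monoˡ-≤ ((suc q) !) bound ⟩
    y * suc n ^ q * (suc q) !                    ≡⟨ *-assoc y (suc n ^ q) ((suc q) !) ⟩
    y * (suc n ^ q * (suc q) !)                  ≤⟨ *-monoʳ-≤ y ([1+1/n]^nm≤e^m n M) ⟩
    y * (n ^ q * e)                              ≡⟨ cong (y *_) (*-comm (n ^ q) e) ⟩
    y * (e * n ^ q)                              ≡⟨ *-assoc y e (n ^ q) ⟨
    y * e * n ^ q                                ∎))
  where
  q = n * M
  e = scaledExp 1 M (suc q)
  swap : ∀ a b c → a * b * c ≡ a * c * b
  swap = solve-∀

-- The claim multiplied out and raised to the power d - 1: (d-1)(d-1-1/(d-1)) = d(d-2), and e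
-- receives (d-1) + (d-1)(1+1/(d-1))n = (d-1) + dn. Every partial sum is below the exponential, so a
-- single `N` suffices.
theorem7p4 : (d n : ℕ) → 2 ≤ d → 1 ≤ n →
    Σ[ L ∈ List (SElem (Id d 2) n) ] (DistinctList L ×
    ∃[ N ] (ℕ→ℚ ((n !) ^ (d * (d ∸ 2)))
    ℚ.≤ ℕ→ℚ ((length L * n) ^ (d ∸ 1)) ℚ.* expPartial ((d ∸ 1) + d * n) N))
theorem7p4 (suc (suc m)) n (s≤s (s≤s z≤n)) 1≤n =
  let L , 1≤L , L≤n , L!^D≤2n^L , few-chains = threshold n m 1≤n
      vs   = avoiders n m L
      ncds = All.tabulate (avoiders-noCommonDescent n m L)
  in toElems vs ncds , toElems-distinct vs ncds (avoiders-unique n m L) ,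
     exponential-bound n {{>-nonZero 1≤n}} (suc m + (2 + m) * n) ((n !) ^ ((2 + m) * m)) ((length (toElems vs ncds) * n) ^ suc m)
       (final-bound m 1≤n (threshold-bound (suc m) 1≤L L≤n L!^D≤2n^L)
         (subst (λ s → (n !) ^ suc m ≤ 2 * L ^ n * s) (sym (length-toElems vs ncds)) (length-avoiders n m L few-chains)))
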